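{- Let $G$ be a connected, well-edge-dominated graph containing exactly one triangle $xyz$. If for every edge $f\in\{xy,xz,yz\}$ the graph $G-N_e[f]$ contains at least two nontrivial components, and each of $x,y,z$ has degree at least $3$ in $G$, then $G\in\mathcal{F}$.
   Context: All graphs are simple and finite. A set $F$ of edges of $G$ is an edge dominating set if every edge of $G$ is in $F$ or shares an endpoint with an edge of $F$. $G$ is well-edge-dominated if all minimal (with respect to inclusion) edge dominating sets of $G$ have the same cardinality. A triangle is a subgraph isomorphic to $K_3$. For an edge $f$, $G-N_e[f]$ denotes the graph obtained from $G$ by deleting both endpoints of $f$ (and all incident edges). A graph is nontrivial if it has at least two vertices. A support vertex is a vertex adjacent to a vertex of degree $1$. Let $G'$ be a well-edge-dominated bipartite graph with bipartition $V(G')=A\cup B$, $|A|<|B|$; a vertex $w\in B$ is strongly detachable if $G'-w$ is well-edge-dominated and every vertex of $N_{G'}(w)$ is a support vertex in $G'-w$. The house graph $\mathcal{H}$ has vertices $p_1,\dots,p_5$ and edges $p_1p_2,p_2p_3,p_3p_4,p_4p_1,p_3p_5,p_4p_5$. $\mathcal{F}$ is the family of graphs obtained from the disjoint union of $\mathcal{H}$ and a well-edge-dominated bipartite graph $G'$ with bipartition $A\cup B$, $|A|<|B|$, by identifying the vertex $p_5$ of $\mathcal{H}$ with a strongly detachable vertex $w\in B$ of $G'$. -}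

module Defs where

open import Data.Nat using (ℕ; zero; suc; _+_; _<_; _≤_)
open import Data.Bool using (Bool; true; false; if_then_else_; _∧_; _∨_)
open import Data.Fin using (Fin; zero; suc; toℕ; splitAt; punchIn; _≟_)
open import Data.Sum using (_⊎_; inj₁; inj₂)
open import Data.Product using (Σ; _×_; _,_; ∃)
open import Data.Unit using (⊤)
open import Relation.Nullary using (¬_; does)
open import Relation.Binary.PropositionalEquality using (_≡_; _≢_)
open import Function.Bundles using (_↔_; Inverse)
import Data.Nat as ℕ

record Graph (n : ℕ) : Set where
  field
    adj    : Fin n → Fin n → Bool
    sym    : ∀ i j → adj i j ≡ adj j i
    irrefl : ∀ i → adj i i ≡ false
open Graph public

count : ∀ {n} → (Fin n → Bool) → ℕ
count {zero}  f = 0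
count {suc n} f = (if f zero then 1 else 0) + count (λ i → f (suc i))

sumFin : ∀ {n} → (Fin n → ℕ) → ℕ
sumFin {zero}  f = 0
sumFin {suc n} f = f zero + sumFin (λ i → f (suc i))

deg : ∀ {n} → Graph n → Fin n → ℕ
deg G i = count (adj G i)

EdgeSet : ℕ → Set
EdgeSet n = Fin n → Fin n → Bool

IsEdgeSet : ∀ {n} → Graph n → EdgeSet n → Set
IsEdgeSet G S = (∀ i j → S i j ≡ S j i) × (∀ i j → S i j ≡ true → adj G i j ≡ true)

size : ∀ {n} → EdgeSet n → ℕ
size S = sumFin (λ i → count (λ j → S i j ∧ (toℕ i ℕ.<ᵇ toℕ j)))

_⊆ₑ_ : ∀ {n} → EdgeSet n → EdgeSet n → Set
S ⊆ₑ T = ∀ i j → S i j ≡ true → T i j ≡ true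

IsEDS : ∀ {n} → Graph n → EdgeSet n → Set
IsEDS G S = IsEdgeSet G S ×
  (∀ u v → adj G u v ≡ true →
     Σ _ λ a → Σ _ λ b → S a b ≡ true × (a ≡ u ⊎ a ≡ v ⊎ b ≡ u ⊎ b ≡ v))

IsMinimalEDS : ∀ {n} → Graph n → EdgeSet n → Set
IsMinimalEDS G S = IsEDS G S × (∀ T → IsEDS G T → T ⊆ₑ S → S ⊆ₑ T)

WellEdgeDominated : ∀ {n} → Graph n → Set
WellEdgeDominated G =
  ∀ S T → IsMinimalEDS G S → IsMinimalEDS G T → size S ≡ size T

data Walk {n} (G : Graph n) (P : Fin n → Set) : Fin n → Fin n → Set where
  here : ∀ {u} → P u → Walk G P u u
  step : ∀ {u v w} → P u → adj G u v ≡ true → Walk G P v w → Walk G P u w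

Connected : ∀ {n} → Graph n → Set
Connected G = ∀ u v → Walk G (λ _ → ⊤) u v

-- G - N_e[uv] (vertices u, v deleted) has at least two nontrivial components:
-- there are two edges ab, cd of G - {u,v} lying in different components.
TwoNontrivialComponents : ∀ {n} → Graph n → Fin n → Fin n → Set
TwoNontrivialComponents G u v =
  Σ _ λ a → Σ _ λ b → Σ _ λ c → Σ _ λ d →
    P a × P b × P c × P d × adj G a b ≡ true × adj G c d ≡ true × ¬ Walk G P a c
  where
  P : _ → Set
  P w = (w ≢ u) × (w ≢ v)

deleteVertex : ∀ {k} → Graph (suc k) → Fin (suc k) → Graph k
deleteVertex G w = record
  { adj    = λ i j → adj G (punchIn w i) (punchIn w j)
  ; sym    = λ i j → sym G (punchIn w i) (punchIn w j)
  ; irrefl = λ i → irrefl G (punchIn w i) }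

IsSupportVertex : ∀ {n} → Graph n → Fin n → Set
IsSupportVertex G v = Σ _ λ u → adj G v u ≡ true × deg G u ≡ 1

-- col i = true means i ∈ B, col i = false means i ∈ A
IsBipartition : ∀ {n} → Graph n → (Fin n → Bool) → Set
IsBipartition G col = ∀ i j → adj G i j ≡ true → col i ≢ col j

notb : Bool → Bool
notb true = false
notb false = true

StronglyDetachable : ∀ {k} → Graph (suc k) → Fin (suc k) → Set
StronglyDetachable G' w =
  WellEdgeDominated (deleteVertex G' w) ×
  (∀ i → adj G' w (punchIn w i) ≡ true → IsSupportVertex (deleteVertex G' w) i)

-- House graph glued with G' at w.  House vertices p1,p2,p3,p4 are
-- inj₁ 0,1,2,3; p5 is identified with w.  Edges: 4-cycle p1p2p3p4 and p3p5, p4p5.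
c4 : Fin 4 → Fin 4 → Bool
c4 zero (suc zero) = true
c4 zero (suc (suc (suc zero))) = true
c4 (suc zero) zero = true
c4 (suc zero) (suc (suc zero)) = true
c4 (suc (suc zero)) (suc zero) = true
c4 (suc (suc zero)) (suc (suc (suc zero))) = true
c4 (suc (suc (suc zero))) (suc (suc zero)) = true
c4 (suc (suc (suc zero))) zero = true
c4 _ _ = false

isP3orP4 : Fin 4 → Bool
isP3orP4 (suc (suc zero)) = true
isP3orP4 (suc (suc (suc zero))) = true
isP3orP4 _ = false

glueAdj' : ∀ {m} → Graph m → Fin m → Fin 4 ⊎ Fin m → Fin 4 ⊎ Fin m → Bool
glueAdj' G' w (inj₁ a) (inj₁ b) = c4 a b
glueAdj' G' w (inj₁ a) (inj₂ v) = isP3orP4 a ∧ does (v ≟ w)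
glueAdj' G' w (inj₂ v) (inj₁ a) = isP3orP4 a ∧ does (v ≟ w)
glueAdj' G' w (inj₂ u) (inj₂ v) = adj G' u v

glueAdj : ∀ {m} → Graph m → Fin m → Fin (4 + m) → Fin (4 + m) → Bool
glueAdj G' w i j = glueAdj' G' w (splitAt 4 i) (splitAt 4 j)

IsomorphicTo : ∀ {n N} → Graph n → (Fin N → Fin N → Bool) → Set
IsomorphicTo {n} {N} G R =
  Σ (Fin n ↔ Fin N) λ φ → ∀ i j → adj G i j ≡ R (Inverse.to φ i) (Inverse.to φ j)

InFamilyF : ∀ {n} → Graph n → Set
InFamilyF G =
  Σ ℕ λ k → Σ (Graph (suc k)) λ G' → Σ (Fin (suc k) → Bool) λ col → Σ (Fin (suc k)) λ w →
    IsBipartition G' col ×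
    count (λ i → notb (col i)) < count col ×
    WellEdgeDominated G' ×
    col w ≡ true ×
    StronglyDetachable G' w ×
    IsomorphicTo G (glueAdj G' w)

OneOf3 : ∀ {n} → Fin n → Fin n → Fin n → Fin n → Set
OneOf3 x y z a = a ≡ x ⊎ a ≡ y ⊎ a ≡ z

{-# OPTIONS --safe #-}

-- Maximal matchings are minimal edge dominating sets, so all of them have the same size in G and in
-- every graph obtained from G by deleting the ends of a matching.
--
-- Let H = G - {x,y,z}.  The neighbourhoods of x, y, z in H are disjoint, and comparing completions of a
-- maximal matching of H shows that it covers all of them.  Hence among neighbours k, m, l of x, y, z in H
-- two are adjacent, and the component hypotheses single out one corner, say z, whose neighbours in H lie
-- in other components than those of x and y.  Then every neighbour k of x in H is adjacent to every
-- neighbour m of y in H, and a minimal edge dominating set containing a star with three leaves shows that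
-- k and m have no further neighbours; so x, y, z, k, m form a house attached to the rest at z.
--
-- The same star argument at y shows that minimal edge dominating sets of H cover the neighbours of z, which
-- are therefore support vertices.  The rest is bipartite: its sides are the vertices missed by some maximum
-- matching and the vertices covered by all of them.
module Submission where

open import Defs hiding (sym; here; step)
open import Data.Nat using (ℕ; zero; suc; _+_; _≤_; _<_; s≤s; z≤n)
import Data.Nat as ℕ
import Data.Nat.Properties as ℕ
open import Data.Nat.Tactic.RingSolver using (solve-∀)
open import Data.Bool using (Bool; true; false; if_then_else_; _∧_; _∨_)
import Data.Bool.Properties as Bool
open import Data.Fin using (Fin; zero; suc; toℕ; punchIn; punchOut; splitAt; _↑ˡ_; _↑ʳ_; _≟_)
open import Data.Fin.Patterns
open import Data.Fin.Permutation as Permutation using (Permutation; _⟨$⟩ʳ_; _⟨$⟩ˡ_; inverseˡ; inverseʳ)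
open import Data.Fin.Properties using (any?; all?; toℕ-injective; suc-injective; punchInᵢ≢i; punchIn-injective; punchIn-punchOut; punchOut-injective; splitAt-↑ˡ; splitAt-↑ʳ; splitAt⁻¹-↑ˡ; splitAt⁻¹-↑ʳ)
open import Data.Fin.Subset.Properties using (anySubset?)
open import Data.Sum using (_⊎_; inj₁; inj₂; [_,_])
open import Data.Product using (Σ; _×_; _,_; ∃-syntax; proj₁; proj₂)
open import Data.Empty using (⊥; ⊥-elim)
open import Data.Unit using (⊤; tt)
open import Data.List using (List; []; _∷_; length; _++_; map; filter; lookup; allFin; cartesianProduct)
import Data.List.Properties as List
open import Data.List.Relation.Unary.Any using (here; there; index)
open import Data.List.Relation.Unary.Any.Properties using (lookup-index)
open import Data.List.Membership.Propositional using (_∈_; _∉_)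
open import Data.List.Membership.Propositional.Properties using (∈-++⁺ˡ; ∈-++⁺ʳ; ∈-++⁻; ∈-map⁺; ∈-map⁻; ∈-lookup; ∈-filter⁺; ∈-allFin; ∈-cartesianProduct⁺)
open import Data.List.Relation.Binary.Subset.Propositional using (_⊆_)
import Data.Vec as Vec
open import Data.Vec.Properties using (lookup∘tabulate)
open import Relation.Nullary using (¬_; Dec; yes; no; does)
open import Relation.Nullary.Decidable using (True; toWitness; _×-dec_; _⊎-dec_; _→-dec_; ¬?; dec-true; dec-false; decidable-stable)
open import Relation.Binary.PropositionalEquality using (_≡_; _≢_; refl; sym; trans; cong; cong₂; subst; module ≡-Reasoning)
open import Relation.Binary.Definitions using (tri<; tri≈; tri>)
open import Function using (_∘_; id; case_of_)
open import Function.Bundles using (mk⇔; Equivalence)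

-- The number `suc h` is the common size of all minimal edge dominating sets of G, so H has matching
-- number h. Most contradictions compare two sets that agree outside a few named vertices and differ
-- there by one edge. Maximal matchings alone already yield the adjacencies; a star with three
-- leaves is not a matching, and it brings in what well-edge-domination says beyond equality of
-- maximal matchings.
--
-- Minimality is used in a local form, a private edge for each member, which can be checked near the
-- vertices being changed.
--
-- Bipartiteness rests on one coincidence: the rest has the same matching number with and without z.
-- For a path w a p, this property of w passes to p once w and a are deleted, so an induction along
-- paths from z shows that every edge has exactly one end missed by some maximum matching.
--
-- Components and missed vertices are defined by existence and are available as Boolean sets only
-- under double negation. Hence they serve only to refute or to reach decidable conclusions: the
-- house is found by search before it is known which corner is separated, and the colouring is found
-- by search among all subsets.

does⁻ : ∀ {A : Set} (A? : Dec A) → does A? ≡ true → A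
does⁻ (yes a) _ = a

true⇔true : ∀ {a b} → (a ≡ true → b ≡ true) → (b ≡ true → a ≡ true) → a ≡ b
true⇔true f g = Bool.⇔→≡ (mk⇔ f g)

∧-true : ∀ {a b} → a ∧ b ≡ true → a ≡ true × b ≡ true
∧-true {true} {true} _ = refl , refl

-- Counting on finite sets.

indicator : Bool → ℕ
indicator b = if b then 1 else 0

count-cong : ∀ {n} {f g : Fin n → Bool} → (∀ i → f i ≡ g i) → count f ≡ count g
count-cong {zero}  f≗g = refl
count-cong {suc n} f≗g = cong₂ _+_ (cong indicator (f≗g zero)) (count-cong (f≗g ∘ suc))

sumFin-cong : ∀ {n} {f g : Fin n → ℕ} → (∀ i → f i ≡ g i) → sumFin f ≡ sumFin g
sumFin-cong {zero}  f≗g = refl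
sumFin-cong {suc n} f≗g = cong₂ _+_ (f≗g zero) (sumFin-cong (f≗g ∘ suc))

sumFin-punchIn : ∀ {n} (f : Fin (suc n) → ℕ) v → sumFin f ≡ f v + sumFin (f ∘ punchIn v)
sumFin-punchIn f zero = refl
sumFin-punchIn {suc n} f (suc v) = begin
  f zero + sumFin (f ∘ suc)                                    ≡⟨ cong (f zero +_) (sumFin-punchIn (f ∘ suc) v) ⟩
  f zero + (f (suc v) + sumFin (f ∘ suc ∘ punchIn v))          ≡⟨ swap (f zero) (f (suc v)) _ ⟩
  f (suc v) + (f zero + sumFin (f ∘ suc ∘ punchIn v))          ∎
  where
  open ≡-Reasoning
  swap : ∀ a b c → a + (b + c) ≡ b + (a + c)
  swap = solve-∀

count≡sumFin : ∀ {n} (f : Fin n → Bool) → count f ≡ sumFin (indicator ∘ f)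
count≡sumFin {zero}  f = refl
count≡sumFin {suc n} f = cong (indicator (f zero) +_) (count≡sumFin (f ∘ suc))

sumFin-bump : ∀ {n} {f g : Fin n → ℕ} v → g v ≡ suc (f v) → (∀ i → i ≢ v → g i ≡ f i) →
              sumFin g ≡ suc (sumFin f)
sumFin-bump {suc n} {f} {g} v gv g≗f = begin
  sumFin g                              ≡⟨ sumFin-punchIn g v ⟩
  g v + sumFin (g ∘ punchIn v)          ≡⟨ cong₂ _+_ gv (sumFin-cong λ i → g≗f _ (punchInᵢ≢i v i)) ⟩
  suc (f v + sumFin (f ∘ punchIn v))    ≡⟨ cong suc (sumFin-punchIn f v) ⟨
  suc (sumFin f)                        ∎
  where open ≡-Reasoning

count-bump : ∀ {n} {f g : Fin n → Bool} v → f v ≡ false → g v ≡ true →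
             (∀ i → i ≢ v → g i ≡ f i) → count g ≡ suc (count f)
count-bump {f = f} {g} v fv gv g≗f = begin
  count g                       ≡⟨ count≡sumFin g ⟩
  sumFin (indicator ∘ g)        ≡⟨ sumFin-bump v eq (λ i i≢v → cong indicator (g≗f i i≢v)) ⟩
  suc (sumFin (indicator ∘ f))  ≡⟨ cong suc (count≡sumFin f) ⟨
  suc (count f)                 ∎
  where
  open ≡-Reasoning
  eq : indicator (g v) ≡ suc (indicator (f v))
  eq rewrite fv | gv = refl

count-positive : ∀ {n} (f : Fin n → Bool) → 0 < count f → ∃[ i ] f i ≡ true
count-positive {suc n} f p with f zero in eq
... | true  = zero , eq
... | false with count-positive (f ∘ suc) p
...   | i , fi = suc i , fi

_∖_ : ∀ {n} → (Fin n → Bool) → Fin n → Fin n → Bool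
(f ∖ v) i = f i ∧ does (¬? (i ≟ v))

∖-true : ∀ {n} (f : Fin n → Bool) v {i} → (f ∖ v) i ≡ true → f i ≡ true × i ≢ v
∖-true f v {i} p with ∧-true p
... | fi , q = fi , does⁻ (¬? (i ≟ v)) q

∖-other : ∀ {n} (f : Fin n → Bool) v {i} → i ≢ v → (f ∖ v) i ≡ f i
∖-other f v {i} i≢v rewrite dec-false (i ≟ v) i≢v = Bool.∧-identityʳ _

∖-self : ∀ {n} (f : Fin n → Bool) v → (f ∖ v) v ≡ false
∖-self f v rewrite dec-true (v ≟ v) refl = Bool.∧-zeroʳ _

count-∖ : ∀ {n} (f : Fin n → Bool) v → f v ≡ true → count f ≡ suc (count (f ∖ v))
count-∖ f v fv = count-bump v (∖-self f v) fv λ i i≢v → sym (∖-other f v i≢v)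

count-∖-≤ : ∀ {n} (f : Fin n → Bool) v → count f ≤ suc (count (f ∖ v))
count-∖-≤ f v with f v in eq
... | true  = ℕ.≤-reflexive (count-∖ f v eq)
... | false = ℕ.m≤n⇒m≤1+n (ℕ.≤-reflexive (count-cong λ i → lem i (i ≟ v)))
  where
  lem : ∀ i → Dec (i ≡ v) → f i ≡ (f ∖ v) i
  lem i (yes refl) = trans eq (sym (∖-self f v))
  lem i (no i≢v)   = sym (∖-other f v i≢v)

-- Each listed vertex lowers the count by at most one. This turns degree at least three into a
-- neighbour outside the triangle, and degree at least two into a second neighbour.
count-avoid : ∀ {n} (xs : List (Fin n)) (f : Fin n → Bool) → length xs < count f →
              ∃[ i ] f i ≡ true × i ∉ xs
count-avoid [] f p with count-positive f p
... | i , fi = i , fi , λ ()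
count-avoid (x ∷ xs) f p
  with count-avoid xs (f ∖ x) (ℕ.≤-pred (ℕ.≤-trans p (count-∖-≤ f x)))
... | i , fi , i∉ with ∖-true f x fi
...   | fi′ , i≢x = i , fi′ , λ { (here i≡x) → i≢x i≡x ; (there i∈) → i∉ i∈ }

-- Induction removes the image of the first element from `g`, and injectivity keeps the later images
-- available. The map is a relation because in its use it is membership of a pair in a matching.
count-injection : ∀ {m n} (f : Fin m → Bool) (g : Fin n → Bool) (_⇝_ : Fin m → Fin n → Set) →
                  (∀ i → f i ≡ true → ∃[ j ] g j ≡ true × i ⇝ j) →
                  (∀ {i i′ j} → i ⇝ j → i′ ⇝ j → i ≡ i′) →
                  count f ≤ count g
count-injection {zero}  f g _⇝_ image injective = z≤n
count-injection {suc m} f g _⇝_ image injective with f zero in eq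
... | false = count-injection (f ∘ suc) g (λ i j → suc i ⇝ j) (image ∘ suc)
                (λ p q → suc-injective (injective p q))
... | true with image zero eq
...   | j , gj , 0⇝j = subst (suc (count (f ∘ suc)) ≤_) (sym (count-∖ g j gj))
        (s≤s (count-injection (f ∘ suc) (g ∖ j) (λ i k → suc i ⇝ k) image′
               (λ p q → suc-injective (injective p q))))
  where
  image′ : ∀ i → f (suc i) ≡ true → ∃[ k ] (g ∖ j) k ≡ true × (suc i ⇝ k)
  image′ i fi with image (suc i) fi
  ... | k , gk , i⇝k = k , trans (∖-other g j λ { refl → case injective 0⇝j i⇝k of λ () }) gk , i⇝k

-- Edge sets and their size.

Symmetric : ∀ {n} → EdgeSet n → Set
Symmetric S = ∀ i j → S i j ≡ S j i

_≐_ : ∀ {n} → EdgeSet n → EdgeSet n → Set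
S ≐ T = ∀ i j → S i j ≡ T i j

∅ : ∀ {n} → EdgeSet n
∅ _ _ = false

count-∅ : ∀ n → count {n} (λ _ → false) ≡ 0
count-∅ zero    = refl
count-∅ (suc n) = count-∅ n

size-∅ : ∀ n → size {n} ∅ ≡ 0
size-∅ n = go n
  where
  go : ∀ k → sumFin {k} (λ _ → count {n} (λ _ → false)) ≡ 0
  go zero    = refl
  go (suc k) = cong₂ _+_ (count-∅ n) (go k)

SameEdge : ∀ {n} → Fin n → Fin n → Fin n → Fin n → Set
SameEdge c d a b = (c ≡ a × d ≡ b) ⊎ (c ≡ b × d ≡ a)

abstract
  sameEdge? : ∀ {n} (c d a b : Fin n) → Dec (SameEdge c d a b)
  sameEdge? c d a b = (c ≟ a ×-dec d ≟ b) ⊎-dec (c ≟ b ×-dec d ≟ a)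

sameEdge-swap : ∀ {n} {c d a b : Fin n} → SameEdge c d a b → SameEdge d c a b
sameEdge-swap (inj₁ (p , q)) = inj₂ (q , p)
sameEdge-swap (inj₂ (p , q)) = inj₁ (q , p)

insert : ∀ {n} → Fin n → Fin n → EdgeSet n → EdgeSet n
insert u v S i j = does (sameEdge? i j u v) ∨ S i j

delete : ∀ {n} → Fin n → Fin n → EdgeSet n → EdgeSet n
delete u v S i j = does (¬? (sameEdge? i j u v)) ∧ S i j

module _ {n} {u v : Fin n} {S : EdgeSet n} where

  insert⁻ : ∀ {i j} → insert u v S i j ≡ true → SameEdge i j u v ⊎ S i j ≡ true
  insert⁻ {i} {j} p with sameEdge? i j u v
  ... | yes e = inj₁ e
  ... | no _  = inj₂ p

  insert-new : ∀ {i j} → SameEdge i j u v → insert u v S i j ≡ true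
  insert-new {i} {j} e rewrite dec-true (sameEdge? i j u v) e = refl

  insert-old : ∀ {i j} → S i j ≡ true → insert u v S i j ≡ true
  insert-old {i} {j} p rewrite p = Bool.∨-zeroʳ _

  delete⁻ : ∀ {i j} → delete u v S i j ≡ true → ¬ SameEdge i j u v × S i j ≡ true
  delete⁻ {i} {j} p with ∧-true p
  ... | q , s = does⁻ (¬? (sameEdge? i j u v)) q , s

  delete⁺ : ∀ {i j} → ¬ SameEdge i j u v → S i j ≡ true → delete u v S i j ≡ true
  delete⁺ {i} {j} e p rewrite dec-false (sameEdge? i j u v) e = p

  insert-symmetric : Symmetric S → Symmetric (insert u v S)
  insert-symmetric s i j = true⇔true (half i j) (half j i)
    where
    half : ∀ i j → insert u v S i j ≡ true → insert u v S j i ≡ true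
    half i j p with insert⁻ p
    ... | inj₁ e = insert-new (sameEdge-swap e)
    ... | inj₂ q = insert-old (trans (s j i) q)

  delete-symmetric : Symmetric S → Symmetric (delete u v S)
  delete-symmetric s i j = true⇔true (half i j) (half j i)
    where
    half : ∀ i j → delete u v S i j ≡ true → delete u v S j i ≡ true
    half i j p with delete⁻ p
    ... | e , q = delete⁺ (e ∘ sameEdge-swap) (trans (s j i) q)

size-cong : ∀ {n} {S T : EdgeSet n} → S ≐ T → size S ≡ size T
size-cong S≐T = sumFin-cong λ i → count-cong λ j → cong (_∧ _) (S≐T i j)

private
  <ᵇ-true : ∀ {a b} → a < b → (a ℕ.<ᵇ b) ≡ true
  <ᵇ-true p = Bool.T-≡ .Equivalence.to (ℕ.<⇒<ᵇ p)

  <ᵇ⁻ : ∀ a b → (a ℕ.<ᵇ b) ≡ true → a < b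
  <ᵇ⁻ a b p = ℕ.<ᵇ⇒< a b (Bool.T-≡ .Equivalence.from p)

  size-insert-< : ∀ {n} {u v : Fin n} {S} → toℕ u < toℕ v → S u v ≡ false →
                  size (insert u v S) ≡ suc (size S)
  size-insert-< {u = u} {v} {S} u<v Suv = sumFin-bump u row other
    where
    cell : ∀ {i j} → ¬ (i ≡ u × j ≡ v) →
           (insert u v S i j ∧ (toℕ i ℕ.<ᵇ toℕ j)) ≡ (S i j ∧ (toℕ i ℕ.<ᵇ toℕ j))
    cell {i} {j} ne = true⇔true to from
      where
      to : (insert u v S i j ∧ (toℕ i ℕ.<ᵇ toℕ j)) ≡ true → (S i j ∧ (toℕ i ℕ.<ᵇ toℕ j)) ≡ true
      to p with ∧-true p
      ... | q , lt with insert⁻ {S = S} q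
      ...   | inj₁ (inj₁ e)             = ⊥-elim (ne e)
      ...   | inj₁ (inj₂ (refl , refl)) = ⊥-elim (ℕ.<-asym u<v (<ᵇ⁻ (toℕ v) (toℕ u) lt))
      ...   | inj₂ s = cong₂ _∧_ s lt
      from : (S i j ∧ (toℕ i ℕ.<ᵇ toℕ j)) ≡ true → (insert u v S i j ∧ (toℕ i ℕ.<ᵇ toℕ j)) ≡ true
      from p with ∧-true p
      ... | s , lt = cong₂ _∧_ (insert-old {S = S} s) lt
    row : count (λ j → insert u v S u j ∧ (toℕ u ℕ.<ᵇ toℕ j)) ≡
          suc (count (λ j → S u j ∧ (toℕ u ℕ.<ᵇ toℕ j)))
    row = count-bump v (cong (_∧ _) Suv)
            (cong₂ _∧_ (insert-new {S = S} (inj₁ (refl , refl))) (<ᵇ-true u<v))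
            (λ j j≢v → cell (j≢v ∘ proj₂))
    other : ∀ i → i ≢ u → count (λ j → insert u v S i j ∧ (toℕ i ℕ.<ᵇ toℕ j)) ≡
            count (λ j → S i j ∧ (toℕ i ℕ.<ᵇ toℕ j))
    other i i≢u = count-cong {f = λ j → insert u v S i j ∧ (toℕ i ℕ.<ᵇ toℕ j)} λ j → cell {i} {j} (i≢u ∘ proj₁)

insert-flip : ∀ {n} {u v : Fin n} {S} → insert u v S ≐ insert v u S
insert-flip {u = u} {v} {S} i j = true⇔true half half
  where
  half : ∀ {a b} → insert a b S i j ≡ true → insert b a S i j ≡ true
  half p with insert⁻ {S = S} p
  ... | inj₁ (inj₁ e) = insert-new {S = S} (inj₂ e)
  ... | inj₁ (inj₂ e) = insert-new {S = S} (inj₁ e)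
  ... | inj₂ s        = insert-old {S = S} s

-- `size` counts an edge in the row of its smaller end, so the two orders of u and v are treated
-- separately.
size-insert : ∀ {n} {u v : Fin n} {S} → Symmetric S → u ≢ v → S u v ≡ false →
              size (insert u v S) ≡ suc (size S)
size-insert {u = u} {v} {S} s u≢v Suv with ℕ.<-cmp (toℕ u) (toℕ v)
... | tri< u<v _ _ = size-insert-< u<v Suv
... | tri≈ _ u≡v _ = ⊥-elim (u≢v (toℕ-injective u≡v))
... | tri> _ _ v<u = trans (size-cong (insert-flip {u = u} {v} {S})) (size-insert-< v<u (trans (s v u) Suv))

-- Recursion on `size`, removing one edge at a time; pointwise agreement stands in for equality of
-- edge sets.
edgeSet-induction : ∀ {n} (Q : EdgeSet n → Set) →
  (∀ {S T} → S ≐ T → Q S → Q T) → Q ∅ →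
  (∀ {u v S} → Symmetric S → u ≢ v → S u v ≡ false → Q S → Q (insert u v S)) →
  ∀ S → Symmetric S → (∀ i → S i i ≡ false) → Q S
edgeSet-induction {n} Q resp base grow S s ir = go (size S) S s ir refl
  where
  go : ∀ t (S : EdgeSet n) → Symmetric S → (∀ i → S i i ≡ false) → size S ≡ t → Q S
  go t S s ir eq with any? (λ u → any? (λ v → S u v Bool.≟ true))
  ... | no none = resp (λ i j → sym (Bool.¬-not λ Sij → none (i , j , Sij))) base
  ... | yes (u , v , Suv) = body t eq
    where
    S′ : EdgeSet n
    S′ = delete u v S
    S′uv : S′ u v ≡ false
    S′uv = Bool.¬-not λ p → proj₁ (delete⁻ {S = S} p) (inj₁ (refl , refl))
    S≐ : insert u v S′ ≐ S
    S≐ i j = true⇔true to from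
      where
      to : insert u v S′ i j ≡ true → S i j ≡ true
      to p with insert⁻ {S = S′} p
      ... | inj₁ (inj₁ (refl , refl)) = Suv
      ... | inj₁ (inj₂ (refl , refl)) = trans (s v u) Suv
      ... | inj₂ q = proj₂ (delete⁻ {S = S} q)
      from : S i j ≡ true → insert u v S′ i j ≡ true
      from p with sameEdge? i j u v
      ... | yes _ = refl
      ... | no _ = p
    u≢v : u ≢ v
    u≢v refl = case trans (sym Suv) (ir u) of λ ()
    s′ : Symmetric S′
    s′ = delete-symmetric {S = S} s
    size≡ : suc (size S′) ≡ size S
    size≡ = trans (sym (size-insert s′ u≢v S′uv)) (size-cong S≐)
    body : ∀ t → size S ≡ t → Q S
    body zero eq = case trans size≡ eq of λ ()
    body (suc t) eq = resp S≐ (grow s′ u≢v S′uv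
      (go t S′ s′ (λ i → Bool.¬-not λ p → case trans (sym (proj₂ (delete⁻ {S = S} p))) (ir i) of λ ())
         (ℕ.suc-injective (trans size≡ eq))))

-- Images of edge sets under a map of vertices.

module _ {m n} (ψ : Fin m → Fin n) where

  abstract
    image : EdgeSet m → EdgeSet n
    image S i j = does (any? λ a → any? λ b → (ψ a ≟ i ×-dec ψ b ≟ j) ×-dec (S a b Bool.≟ true))

    image⁻ : ∀ {S i j} → image S i j ≡ true → ∃[ a ] ∃[ b ] (ψ a ≡ i × ψ b ≡ j) × S a b ≡ true
    image⁻ = does⁻ (any? λ a → any? λ b → _)

    image⁺ : ∀ {S a b} → S a b ≡ true → image S (ψ a) (ψ b) ≡ true
    image⁺ {S} {a} {b} p = dec-true (any? λ a → any? λ b → _) (a , b , (refl , refl) , p)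

  image-symmetric : ∀ {S} → Symmetric S → Symmetric (image S)
  image-symmetric {S} s i j = true⇔true (half i j) (half j i)
    where
    half : ∀ i j → image S i j ≡ true → image S j i ≡ true
    half i j p with image⁻ p
    ... | a , b , (refl , refl) , Sab = image⁺ (trans (s b a) Sab)

  module _ (ψ-injective : ∀ {a b} → ψ a ≡ ψ b → a ≡ b) where

    image⁻ψ : ∀ {S a b} → image S (ψ a) (ψ b) ≡ true → S a b ≡ true
    image⁻ψ {S} p with image⁻ p
    ... | a , b , (p , q) , Sab rewrite ψ-injective p | ψ-injective q = Sab

    -- An injection need not respect the order of indices on which `size` depends, so rows cannot be
    -- compared; building the set edge by edge avoids the order.
    size-image : ∀ S → Symmetric S → (∀ i → S i i ≡ false) → size (image S) ≡ size S
    size-image = edgeSet-induction (λ S → size (image S) ≡ size S)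
      (λ S≐T eq → trans (trans (size-cong (image-cong (λ i j → sym (S≐T i j)))) eq) (size-cong S≐T))
      (trans (size-cong {T = ∅} image-∅) (trans (size-∅ n) (sym (size-∅ m))))
      step
      where
      image-cong : ∀ {S T} → S ≐ T → image S ≐ image T
      image-cong {S} {T} S≐T i j = true⇔true (half S≐T) (half (λ a b → sym (S≐T a b)))
        where
        half : ∀ {S T} → S ≐ T → image S i j ≡ true → image T i j ≡ true
        half {S} {T} S≐T p with image⁻ {S} p
        ... | a , b , (refl , refl) , Sab = image⁺ (trans (sym (S≐T a b)) Sab)
      image-∅ : image ∅ ≐ ∅
      image-∅ i j = Bool.¬-not λ p → case proj₂ (proj₂ (proj₂ (image⁻ {∅} p))) of λ ()
      step : ∀ {u v S} → Symmetric S → u ≢ v → S u v ≡ false → size (image S) ≡ size S →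
             size (image (insert u v S)) ≡ size (insert u v S)
      step {u} {v} {S} s u≢v Suv eq = begin
        size (image (insert u v S))          ≡⟨ size-cong commute ⟩
        size (insert (ψ u) (ψ v) (image S))  ≡⟨ size-insert (image-symmetric s) (u≢v ∘ ψ-injective)
                                                  (Bool.¬-not λ p → case trans (sym (image⁻ψ p)) Suv of λ ()) ⟩
        suc (size (image S))                 ≡⟨ cong suc eq ⟩
        suc (size S)                         ≡⟨ size-insert s u≢v Suv ⟨
        size (insert u v S)                  ∎
        where
        open ≡-Reasoning
        commute : image (insert u v S) ≐ insert (ψ u) (ψ v) (image S)
        commute i j = true⇔true to from
          where
          to : image (insert u v S) i j ≡ true → insert (ψ u) (ψ v) (image S) i j ≡ true
          to p with image⁻ {insert u v S} p
          ... | a , b , (refl , refl) , q with insert⁻ {S = S} q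
          ...   | inj₁ (inj₁ (refl , refl)) = insert-new {S = image S} (inj₁ (refl , refl))
          ...   | inj₁ (inj₂ (refl , refl)) = insert-new {S = image S} (inj₂ (refl , refl))
          ...   | inj₂ r = insert-old {S = image S} (image⁺ r)
          from : insert (ψ u) (ψ v) (image S) i j ≡ true → image (insert u v S) i j ≡ true
          from p with insert⁻ {S = image S} p
          ... | inj₁ (inj₁ (refl , refl)) = image⁺ {insert u v S} (insert-new {S = S} (inj₁ (refl , refl)))
          ... | inj₁ (inj₂ (refl , refl)) = image⁺ {insert u v S} (insert-new {S = S} (inj₂ (refl , refl)))
          ... | inj₂ q with image⁻ {S} q
          ...   | a , b , (refl , refl) , r = image⁺ {insert u v S} (insert-old {S = S} r)

-- Lists of vertices.

module _ {n : ℕ} where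
  open import Data.List.Membership.DecPropositional (_≟_ {n}) public using (_∈?_; _∉?_)

infixr 5 _∉∷_
_∉∷_ : ∀ {A : Set} {p a : A} {R} → p ≢ a → p ∉ R → p ∉ a ∷ R
(p≢a ∉∷ p∉R) (here p≡a)  = p≢a p≡a
(p≢a ∉∷ p∉R) (there p∈R) = p∉R p∈R

cons-⊆ : ∀ {A : Set} {a : A} {R R′} → R ⊆ R′ → a ∷ R ⊆ a ∷ R′
cons-⊆ s (here p)  = here p
cons-⊆ s (there p) = there (s p)

pull₁ : ∀ {A : Set} {a b : A} {R} → b ∷ a ∷ R ⊆ a ∷ b ∷ R
pull₁ (here p)          = there (here p)
pull₁ (there (here p))  = here p
pull₁ (there (there p)) = there (there p)

pull₂ : ∀ {A : Set} {a b c : A} {R} → b ∷ c ∷ a ∷ R ⊆ a ∷ b ∷ c ∷ R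
pull₂ (here p)                  = there (here p)
pull₂ (there (here p))          = there (there (here p))
pull₂ (there (there (here p)))  = here p
pull₂ (there (there (there p))) = there (there (there p))

cov : ∀ {n} → List (Fin n × Fin n) → List (Fin n)
cov []            = []
cov ((u , v) ∷ L) = u ∷ v ∷ cov L

cov-++ : ∀ {n} (L M : List (Fin n × Fin n)) → cov (L ++ M) ≡ cov L ++ cov M
cov-++ [] M            = refl
cov-++ ((u , v) ∷ L) M = cong (λ K → u ∷ v ∷ K) (cov-++ L M)

-- Minimal edge dominating sets of G - R.

module Domination {n} (G : Graph n) where

  V : Set
  V = Fin n

  infix 4 _~_ _~?_
  _~_ : V → V → Set
  u ~ v = adj G u v ≡ true

  _~?_ : ∀ u v → Dec (u ~ v)
  u ~? v = adj G u v Bool.≟ true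

  ~-sym : ∀ {u v} → u ~ v → v ~ u
  ~-sym {u} {v} e = trans (Graph.sym G v u) e

  ~⇒≢ : ∀ {u v} → u ~ v → u ≢ v
  ~⇒≢ {u} e refl = case trans (sym e) (irrefl G u) of λ ()

  ~-cong : ∀ {u u′ v v′} → u ≡ u′ → v ≡ v′ → u ~ v → u′ ~ v′
  ~-cong refl refl e = e

  Touches : EdgeSet n → V → Set
  Touches S u = ∃[ d ] S u d ≡ true

  -- The edge pq of G - R is dominated by no member other than ab. Having such an edge for every
  -- member is minimality, expressed without quantifying over edge sets.
  Private : List V → EdgeSet n → V → V → Set
  Private R S a b = ∃[ p ] ∃[ q ] p ~ q × p ∉ R × q ∉ R ×
    (∀ c d → S c d ≡ true → c ≡ p ⊎ c ≡ q → SameEdge c d a b)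

  -- Throughout, R lists deleted vertices: S is an edge dominating set of G - R.
  record Dominating (R : List V) (S : EdgeSet n) : Set where
    field
      symm  : Symmetric S
      edge  : ∀ {i j} → S i j ≡ true → i ~ j
      avoid : ∀ {i j} → S i j ≡ true → i ∉ R
      dom   : ∀ {u v} → u ~ v → u ∉ R → v ∉ R → Touches S u ⊎ Touches S v
    flip : ∀ {i j} → S i j ≡ true → S j i ≡ true
    flip {i} {j} p = trans (symm j i) p
    irreflexive : ∀ i → S i i ≡ false
    irreflexive i = Bool.¬-not λ p → ~⇒≢ (edge p) refl
    untouched : ∀ {i j} → i ∈ R → S i j ≡ false
    untouched i∈R = Bool.¬-not λ p → avoid p i∈R

  record Good (R : List V) (S : EdgeSet n) : Set where
    field
      dominating : Dominating R S
      priv       : ∀ {a b} → S a b ≡ true → Private R S a b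
    open Dominating dominating public

  module _ (R : List V) where

    private? : ∀ S a b → Dec (Private R S a b)
    private? S a b = any? λ p → any? λ q → (p ~? q) ×-dec ((p ∉? R) ×-dec ((q ∉? R) ×-dec
      (all? λ c → all? λ d → (S c d Bool.≟ true) →-dec (((c ≟ p) ⊎-dec (c ≟ q)) →-dec sameEdge? c d a b))))

    -- If ab has no private edge, every edge of G - R is met by some other member, and that member
    -- stays.
    delete-dominating : ∀ {S a b} → Dominating R S → ¬ Private R S a b → Dominating R (delete a b S)
    delete-dominating {S} {a} {b} D np = record
      { symm  = delete-symmetric {S = S} D.symm
      ; edge  = λ p → D.edge (proj₂ (delete⁻ {S = S} p))
      ; avoid = λ p → D.avoid (proj₂ (delete⁻ {S = S} p))
      ; dom   = dom′ }
      where
      module D = Dominating D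
      dom′ : ∀ {u v} → u ~ v → u ∉ R → v ∉ R → Touches (delete a b S) u ⊎ Touches (delete a b S) v
      dom′ {u} {v} e u∉ v∉ with any? (λ c → any? (λ d → (S c d Bool.≟ true) ×-dec
                                 (((c ≟ u) ⊎-dec (c ≟ v)) ×-dec ¬? (sameEdge? c d a b))))
      ... | yes (c , d , Scd , inj₁ refl , ne) = inj₁ (d , delete⁺ {S = S} ne Scd)
      ... | yes (c , d , Scd , inj₂ refl , ne) = inj₂ (d , delete⁺ {S = S} ne Scd)
      ... | no none = ⊥-elim (np (u , v , e , u∉ , v∉ , λ c d Scd t →
              decidable-stable (sameEdge? c d a b) λ ne → none (c , d , Scd , t , ne)))

    -- One pass suffices: a private edge stays private when further members are deleted.
    prune : ∀ ps S → Dominating R S →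
            ∃[ T ] Dominating R T × T ⊆ₑ S × (∀ {a b} → (a , b) ∈ ps → T a b ≡ true → Private R T a b)
    prune [] S D = S , D , (λ _ _ p → p) , λ ()
    prune ((a , b) ∷ ps) S D with prune ps S D
    ... | T , D′ , T⊆S , pr with private? T a b
    ...   | yes pab = T , D′ , T⊆S , λ { (here refl) _ → pab ; (there i) t → pr i t }
    ...   | no npab = delete a b T , delete-dominating D′ npab , (λ i j p → T⊆S i j (proj₂ (delete⁻ {S = T} p))) , pr′
      where
      pr′ : ∀ {c d} → (c , d) ∈ (a , b) ∷ ps → delete a b T c d ≡ true → Private R (delete a b T) c d
      pr′ (here refl) t = ⊥-elim (proj₁ (delete⁻ {S = T} t) (inj₁ (refl , refl)))
      pr′ (there i) t with pr i (proj₂ (delete⁻ {S = T} t))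
      ... | p , q , e , p∉ , q∉ , h = p , q , e , p∉ , q∉ , λ c d s → h c d (proj₂ (delete⁻ {S = T} s))

    minimise : ∀ {S} → Dominating R S → ∃[ T ] Good R T × T ⊆ₑ S
    minimise {S} D with prune (cartesianProduct (allFin n) (allFin n)) S D
    ... | T , D′ , T⊆S , pr = T , record { dominating = D′ ; priv = pr (∈-cartesianProduct⁺ (∈-allFin _) (∈-allFin _)) } , T⊆S

  dominating⇒eds : ∀ {S} → Dominating [] S → IsEDS G S
  dominating⇒eds {S} D = (D.symm , λ i j → D.edge) , λ u v e → case D.dom e (λ ()) (λ ()) of λ
    { (inj₁ (d , s)) → u , d , s , inj₁ refl
    ; (inj₂ (d , s)) → v , d , s , inj₂ (inj₁ refl) }
    where module D = Dominating D

  eds⇒dominating : ∀ {S} → IsEDS G S → Dominating [] S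
  eds⇒dominating {S} ((s , e) , d) = record { symm = s ; edge = e _ _ ; avoid = λ _ () ; dom = λ uv _ _ → dom uv }
    where
    dom : ∀ {u v} → u ~ v → Touches S u ⊎ Touches S v
    dom {u} {v} uv with d u v uv
    ... | a , b , p , inj₁ refl                      = inj₁ (b , p)
    ... | a , b , p , inj₂ (inj₁ refl)               = inj₂ (b , p)
    ... | a , b , p , inj₂ (inj₂ (inj₁ refl))        = inj₁ (a , trans (s b a) p)
    ... | a , b , p , inj₂ (inj₂ (inj₂ refl))        = inj₂ (a , trans (s b a) p)

  -- A dominating subset contains a member meeting the private edge of ab, and this can only be ab
  -- itself.
  good⇒minimal : ∀ {S} → Good [] S → IsMinimalEDS G S
  good⇒minimal {S} g = dominating⇒eds g.dominating , minimal
    where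
    module g = Good g
    minimal : ∀ T → IsEDS G T → T ⊆ₑ S → S ⊆ₑ T
    minimal T eds T⊆S a b Sab with g.priv Sab
    ... | p , q , e , _ , _ , h = case Dominating.dom D e (λ ()) (λ ()) of λ
      { (inj₁ (d , t)) → found t (h p d (T⊆S p d t) (inj₁ refl))
      ; (inj₂ (d , t)) → found t (h q d (T⊆S q d t) (inj₂ refl)) }
      where
      D = eds⇒dominating eds
      found : ∀ {c d} → T c d ≡ true → SameEdge c d a b → T a b ≡ true
      found t (inj₁ (refl , refl)) = t
      found t (inj₂ (refl , refl)) = Dominating.flip D t

  -- Pruning a minimal set removes nothing, so its members have the private edges that pruning
  -- guarantees.
  minimal⇒good : ∀ {S} → IsMinimalEDS G S → Good [] S
  minimal⇒good {S} (eds , minimal) with minimise [] (eds⇒dominating eds)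
  ... | T , g , T⊆S = record { dominating = eds⇒dominating eds ; priv = priv }
    where
    S⊆T : S ⊆ₑ T
    S⊆T = minimal T (dominating⇒eds (Good.dominating g)) T⊆S
    priv : ∀ {a b} → S a b ≡ true → Private [] S a b
    priv p with Good.priv g (S⊆T _ _ p)
    ... | x , y , e , x∉ , y∉ , h = x , y , e , x∉ , y∉ , λ c d s → h c d (S⊆T c d s)

  -- The vertices of R outside R′ are isolated in G - R′, so both graphs have the same edges to
  -- dominate.
  rebase : ∀ {R R′ S} → R′ ⊆ R → (∀ {u v} → u ~ v → u ∉ R′ → v ∉ R′ → u ∉ R) → Good R S → Good R′ S
  rebase {R} {R′} sub drop g = record
    { dominating = record
      { symm  = g.symm
      ; edge  = g.edge
      ; avoid = λ p i∈ → g.avoid p (sub i∈)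
      ; dom   = λ e u∉ v∉ → g.dom e (drop e u∉ v∉) (drop (~-sym e) v∉ u∉) }
    ; priv = λ p → case g.priv p of λ (x , y , e , x∉ , y∉ , h) → x , y , e , (x∉ ∘ sub) , (y∉ ∘ sub) , h }
    where module g = Good g

  -- S touches neither u nor v, so uv is its own private edge; the private edges of S avoid u and v
  -- and therefore remain private.
  insert-good : ∀ {R S u v} → u ~ v → u ∉ R → v ∉ R → Good (u ∷ v ∷ R) S → Good R (insert u v S)
  insert-good {R} {S} {u} {v} uv u∉R v∉R g = record
    { dominating = record
      { symm  = insert-symmetric {S = S} g.symm
      ; edge  = λ p → case insert⁻ {S = S} p of λ
          { (inj₁ (inj₁ (refl , refl))) → uv ; (inj₁ (inj₂ (refl , refl))) → ~-sym uv ; (inj₂ s) → g.edge s }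
      ; avoid = λ p → case insert⁻ {S = S} p of λ
          { (inj₁ (inj₁ (refl , _))) → u∉R ; (inj₁ (inj₂ (refl , _))) → v∉R
          ; (inj₂ s) → λ i∈ → g.avoid s (there (there i∈)) }
      ; dom = dom }
    ; priv = priv }
    where
    module g = Good g
    T = insert u v S
    old : ∀ {i} → Touches S i → Touches T i
    old (d , s) = d , insert-old {S = S} s
    Tu : Touches T u
    Tu = v , insert-new {S = S} (inj₁ (refl , refl))
    Tv : Touches T v
    Tv = u , insert-new {S = S} (inj₂ (refl , refl))
    dom : ∀ {i j} → i ~ j → i ∉ R → j ∉ R → Touches T i ⊎ Touches T j
    dom {i} {j} e i∉ j∉ with i ≟ u | i ≟ v | j ≟ u | j ≟ v
    ... | yes refl | _ | _ | _ = inj₁ Tu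
    ... | _ | yes refl | _ | _ = inj₁ Tv
    ... | _ | _ | yes refl | _ = inj₂ Tu
    ... | _ | _ | _ | yes refl = inj₂ Tv
    ... | no a | no b | no c | no d with g.dom e (a ∉∷ b ∉∷ i∉) (c ∉∷ d ∉∷ j∉)
    ...   | inj₁ t = inj₁ (old t)
    ...   | inj₂ t = inj₂ (old t)
    new : Private R T u v
    new = u , v , uv , u∉R , v∉R , λ c d t c∈ → case insert⁻ {S = S} t of λ
      { (inj₁ e) → e
      ; (inj₂ s) → ⊥-elim (g.avoid s (case c∈ of λ { (inj₁ p) → here p ; (inj₂ p) → there (here p) })) }
    priv : ∀ {a b} → T a b ≡ true → Private R T a b
    priv p with insert⁻ {S = S} p
    ... | inj₁ (inj₁ (refl , refl)) = new
    ... | inj₁ (inj₂ (refl , refl)) = case new of λ (x , y , e , x∉ , y∉ , h) →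
            x , y , e , x∉ , y∉ , λ c d t c∈ → case h c d t c∈ of λ { (inj₁ q) → inj₂ q ; (inj₂ q) → inj₁ q }
    ... | inj₂ s with g.priv s
    ...   | x , y , e , x∉ , y∉ , h = x , y , e , (λ i → x∉ (there (there i))) , (λ i → y∉ (there (there i))) ,
              λ c d t c∈ → case insert⁻ {S = S} t of λ
                { (inj₁ (inj₁ (refl , _))) → ⊥-elim (case c∈ of λ { (inj₁ q) → x∉ (here (sym q)) ; (inj₂ q) → y∉ (here (sym q)) })
                ; (inj₁ (inj₂ (refl , _))) → ⊥-elim (case c∈ of λ { (inj₁ q) → x∉ (there (here (sym q))) ; (inj₂ q) → y∉ (there (here (sym q))) })
                ; (inj₂ s) → h c d s c∈ }

  size-insert-good : ∀ {R S u v} → u ~ v → Good (u ∷ v ∷ R) S → size (insert u v S) ≡ suc (size S)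
  size-insert-good uv g = size-insert (Good.symm g) (~⇒≢ uv) (Good.untouched g (here refl))

  module _ {R : List V} {S : EdgeSet n} {c a₁ a₂ a₃ w₁ w₂ w₃ : V}
    (g : Good (c ∷ a₁ ∷ a₂ ∷ a₃ ∷ R) S)
    (c∉ : c ∉ R) (a₁∉ : a₁ ∉ R) (a₂∉ : a₂ ∉ R) (a₃∉ : a₃ ∉ R)
    (a₁≢a₂ : a₁ ≢ a₂) (a₁≢a₃ : a₁ ≢ a₃) (a₂≢a₃ : a₂ ≢ a₃)
    (ca₁ : c ~ a₁) (ca₂ : c ~ a₂) (ca₃ : c ~ a₃)
    (aw₁ : a₁ ~ w₁) (aw₂ : a₂ ~ w₂) (aw₃ : a₃ ~ w₃)
    (w₁∉ : w₁ ∉ c ∷ a₁ ∷ a₂ ∷ a₃ ∷ R) (w₂∉ : w₂ ∉ c ∷ a₁ ∷ a₂ ∷ a₃ ∷ R) (w₃∉ : w₃ ∉ c ∷ a₁ ∷ a₂ ∷ a₃ ∷ R)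
    (Sw₁ : ∀ {d} → S w₁ d ≢ true) (Sw₂ : ∀ {d} → S w₂ d ≢ true) (Sw₃ : ∀ {d} → S w₃ d ≢ true)
    where

    private
      module g = Good g

      S₃ S₂ : EdgeSet n
      S₃ = insert c a₃ S
      S₂ = insert c a₂ S₃

    star : EdgeSet n
    star = insert c a₁ S₂

    private
      data Leaf : V → Set where
        ℓ₁ : Leaf a₁
        ℓ₂ : Leaf a₂
        ℓ₃ : Leaf a₃

      data Member (i j : V) : Set where
        out : i ≡ c → Leaf j → Member i j
        inn : Leaf i → j ≡ c → Member i j
        old : S i j ≡ true → Member i j

      member : ∀ {i j} → star i j ≡ true → Member i j
      member p with insert⁻ {S = S₂} p
      ... | inj₁ (inj₁ (refl , refl)) = out refl ℓ₁
      ... | inj₁ (inj₂ (refl , refl)) = inn ℓ₁ refl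
      ... | inj₂ q with insert⁻ {S = S₃} q
      ...   | inj₁ (inj₁ (refl , refl)) = out refl ℓ₂
      ...   | inj₁ (inj₂ (refl , refl)) = inn ℓ₂ refl
      ...   | inj₂ r with insert⁻ {S = S} r
      ...     | inj₁ (inj₁ (refl , refl)) = out refl ℓ₃
      ...     | inj₁ (inj₂ (refl , refl)) = inn ℓ₃ refl
      ...     | inj₂ s = old s

      old⁺ : ∀ {i j} → S i j ≡ true → star i j ≡ true
      old⁺ s = insert-old {S = S₂} (insert-old {S = S₃} (insert-old {S = S} s))

      leaf⁺ : ∀ {a} → Leaf a → star a c ≡ true
      leaf⁺ ℓ₁ = insert-new {S = S₂} (inj₂ (refl , refl))
      leaf⁺ ℓ₂ = insert-old {S = S₂} (insert-new {S = S₃} (inj₂ (refl , refl)))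
      leaf⁺ ℓ₃ = insert-old {S = S₂} (insert-old {S = S₃} (insert-new {S = S} (inj₂ (refl , refl))))

      leaf~ : ∀ {a} → Leaf a → c ~ a
      leaf~ ℓ₁ = ca₁
      leaf~ ℓ₂ = ca₂
      leaf~ ℓ₃ = ca₃

      leaf∉ : ∀ {a} → Leaf a → a ∉ R
      leaf∉ ℓ₁ = a₁∉
      leaf∉ ℓ₂ = a₂∉
      leaf∉ ℓ₃ = a₃∉

      leaf∈ : ∀ {a} → Leaf a → a ∈ c ∷ a₁ ∷ a₂ ∷ a₃ ∷ R
      leaf∈ ℓ₁ = there (here refl)
      leaf∈ ℓ₂ = there (there (here refl))
      leaf∈ ℓ₃ = there (there (there (here refl)))

      weaken : ∀ {i} → i ∉ c ∷ a₁ ∷ a₂ ∷ a₃ ∷ R → i ∉ R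
      weaken i∉ p = i∉ (there (there (there (there p))))

      symm : Symmetric star
      symm = insert-symmetric {S = S₂} (insert-symmetric {S = S₃} (insert-symmetric {S = S} g.symm))

      flip : ∀ {i j} → star i j ≡ true → star j i ≡ true
      flip {i} {j} p = trans (symm j i) p

      partner : ∀ {a} → Leaf a → ∃[ w ] a ~ w × w ∉ c ∷ a₁ ∷ a₂ ∷ a₃ ∷ R × (∀ {d} → S w d ≢ true)
      partner ℓ₁ = w₁ , aw₁ , w₁∉ , Sw₁
      partner ℓ₂ = w₂ , aw₂ , w₂∉ , Sw₂
      partner ℓ₃ = w₃ , aw₃ , w₃∉ , Sw₃

      leafPrivate : ∀ {a} → Leaf a → Private R star a c
      leafPrivate {a} ℓ with partner ℓ
      ... | w , aw , w∉ , Sw = a , w , aw , leaf∉ ℓ , weaken w∉ , h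
        where
        h : ∀ i j → star i j ≡ true → i ≡ a ⊎ i ≡ w → SameEdge i j a c
        h i j t (inj₁ refl) with member t
        ... | out refl _  = ⊥-elim (~⇒≢ (leaf~ ℓ) refl)
        ... | inn _ refl  = inj₁ (refl , refl)
        ... | old s       = ⊥-elim (g.avoid s (leaf∈ ℓ))
        h i j t (inj₂ refl) with member t
        ... | out refl _  = ⊥-elim (w∉ (here refl))
        ... | inn ℓ′ _    = ⊥-elim (w∉ (leaf∈ ℓ′))
        ... | old s       = ⊥-elim (Sw s)

      priv : ∀ {i j} → star i j ≡ true → Private R star i j
      priv t with member t
      ... | inn ℓ refl = leafPrivate ℓ
      ... | out refl ℓ with leafPrivate ℓ
      ...   | x , y , e , x∉ , y∉ , h = x , y , e , x∉ , y∉ ,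
                λ i j s i∈ → case h i j s i∈ of λ { (inj₁ q) → inj₂ q ; (inj₂ q) → inj₁ q }
      priv t | old s with g.priv s
      ...   | x , y , e , x∉ , y∉ , h = x , y , e , weaken x∉ , weaken y∉ , h′
        where
        outside : ∀ {i} → i ≡ x ⊎ i ≡ y → i ∉ c ∷ a₁ ∷ a₂ ∷ a₃ ∷ R
        outside (inj₁ refl) = x∉
        outside (inj₂ refl) = y∉
        h′ : ∀ i j → star i j ≡ true → i ≡ x ⊎ i ≡ y → SameEdge i j _ _
        h′ i j t i∈ with member t
        ... | out refl _ = ⊥-elim (outside i∈ (here refl))
        ... | inn ℓ _    = ⊥-elim (outside i∈ (leaf∈ ℓ))
        ... | old s      = h i j s i∈

      touched : ∀ {i} → i ∈ c ∷ a₁ ∷ a₂ ∷ a₃ ∷ [] → Touches star i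
      touched (here refl)                         = a₁ , flip (leaf⁺ ℓ₁)
      touched (there (here refl))                 = c , leaf⁺ ℓ₁
      touched (there (there (here refl)))         = c , leaf⁺ ℓ₂
      touched (there (there (there (here refl)))) = c , leaf⁺ ℓ₃

      dom : ∀ {i j} → i ~ j → i ∉ R → j ∉ R → Touches star i ⊎ Touches star j
      dom {i} {j} e i∉ j∉ with i ∈? (c ∷ a₁ ∷ a₂ ∷ a₃ ∷ []) | j ∈? (c ∷ a₁ ∷ a₂ ∷ a₃ ∷ [])
      ... | yes i∈ | _      = inj₁ (touched i∈)
      ... | _      | yes j∈ = inj₂ (touched j∈)
      ... | no i∉′ | no j∉′ with g.dom e (λ p → [ i∉′ , i∉ ] (∈-++⁻ (c ∷ a₁ ∷ a₂ ∷ a₃ ∷ []) p))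
                                      (λ p → [ j∉′ , j∉ ] (∈-++⁻ (c ∷ a₁ ∷ a₂ ∷ a₃ ∷ []) p))
      ...   | inj₁ (d , s) = inj₁ (d , old⁺ s)
      ...   | inj₂ (d , s) = inj₂ (d , old⁺ s)

    -- The edge from a leaf to its partner w is private for the star edge at that leaf, because S
    -- leaves w untouched. One vertex may serve as partner of several leaves.
    star-good : Good R star
    star-good = record
      { dominating = record
        { symm  = symm
        ; edge  = λ t → case member t of λ
            { (out refl ℓ) → leaf~ ℓ ; (inn ℓ refl) → ~-sym (leaf~ ℓ) ; (old s) → g.edge s }
        ; avoid = λ t → case member t of λ
            { (out refl _) → c∉ ; (inn ℓ _) → leaf∉ ℓ ; (old s) → weaken (g.avoid s) }
        ; dom   = dom }
      ; priv = priv }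

    size-star : size star ≡ 3 + size S
    size-star = begin
      size star            ≡⟨ size-insert s₂ (~⇒≢ ca₁) (Bool.¬-not λ p → case insert⁻ {S = S₃} p of λ
                                { (inj₁ e) → clash ca₁ a₁≢a₂ e
                                ; (inj₂ q) → case insert⁻ {S = S} q of λ
                                    { (inj₁ e) → clash ca₁ a₁≢a₃ e ; (inj₂ s) → g.avoid s (here refl) } }) ⟩
      suc (size S₂)        ≡⟨ cong suc (size-insert s₃ (~⇒≢ ca₂) (Bool.¬-not λ p → case insert⁻ {S = S} p of λ
                                { (inj₁ e) → clash ca₂ a₂≢a₃ e ; (inj₂ s) → g.avoid s (here refl) })) ⟩
      suc (suc (size S₃))  ≡⟨ cong (2 +_) (size-insert g.symm (~⇒≢ ca₃) (g.untouched (here refl))) ⟩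
      3 + size S           ∎
      where
      open ≡-Reasoning
      s₃ : Symmetric S₃
      s₃ = insert-symmetric {S = S} g.symm
      s₂ : Symmetric S₂
      s₂ = insert-symmetric {S = S₃} s₃
      clash : ∀ {a b} → c ~ a → a ≢ b → SameEdge c a c b → ⊥
      clash ca a≢b (inj₁ (_ , a≡b)) = a≢b a≡b
      clash ca a≢b (inj₂ (_ , a≡c)) = ~⇒≢ ca (sym a≡c)

    extend-star : ∃[ T ] Good R T × size T ≡ 3 + size S
    extend-star = star , star-good , size-star

  -- Matchings of G - R and equimatchability.

  -- L is a matching of G - R.
  data Valid (R : List V) : List (V × V) → Set where
    []  : Valid R []
    add : ∀ {u v L} → u ~ v → u ∉ R → v ∉ R → Valid (u ∷ v ∷ R) L → Valid R ((u , v) ∷ L)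

  Free : List V → List (V × V) → V → Set
  Free R L p = p ∉ R × p ∉ cov L

  Maximal : List V → List (V × V) → Set
  Maximal R L = ∀ {p q} → p ~ q → Free R L p → Free R L q → ⊥

  disjoint : ∀ {R L p} → Valid R L → p ∈ R → p ∉ cov L
  disjoint (add uv u∉ v∉ val) p∈ (here refl)         = u∉ p∈
  disjoint (add uv u∉ v∉ val) p∈ (there (here refl)) = v∉ p∈
  disjoint (add uv u∉ v∉ val) p∈ (there (there q))   = disjoint val (there (there p∈)) q

  valid-⊆ : ∀ {R R′ L} → R′ ⊆ R → Valid R L → Valid R′ L
  valid-⊆ sub [] = []
  valid-⊆ sub (add uv u∉ v∉ val) = add uv (u∉ ∘ sub) (v∉ ∘ sub) (valid-⊆ (cons-⊆ (cons-⊆ sub)) val)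

  valid-avoid : ∀ {R L p} → Valid R L → p ∉ cov L → Valid (p ∷ R) L
  valid-avoid [] p∉ = []
  valid-avoid (add uv u∉ v∉ val) p∉ =
    add uv ((λ e → p∉ (here (sym e))) ∉∷ u∉) ((λ e → p∉ (there (here (sym e)))) ∉∷ v∉)
      (valid-⊆ pull₂ (valid-avoid val (λ i → p∉ (there (there i)))))

  private
    greedy : ∀ ps R → ∃[ L ] Valid R L ×
             (∀ {p q} → (p , q) ∈ ps → p ~ q → Free R L p → Free R L q → ⊥)
    greedy [] R = [] , [] , λ ()
    greedy ((u , v) ∷ ps) R with (u ~? v) ×-dec ((u ∉? R) ×-dec (v ∉? R))
    ... | yes (uv , u∉ , v∉) with greedy ps (u ∷ v ∷ R)
    ...   | L , val , max = (u , v) ∷ L , add uv u∉ v∉ val , λ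
            { (here refl) _ (_ , p∉) _ → p∉ (here refl)
            ; (there i) e fp fq → max i e (shift fp) (shift fq) }
      where
      shift : ∀ {p} → Free R ((u , v) ∷ L) p → Free (u ∷ v ∷ R) L p
      shift (p∉R , p∉L) = ((p∉L ∘ here) ∉∷ (p∉L ∘ there ∘ here) ∉∷ p∉R) , (p∉L ∘ there ∘ there)
    greedy ((u , v) ∷ ps) R | no ¬uv with greedy ps R
    ... | L , val , max = L , val , λ
            { (here refl) e (p∉ , _) (q∉ , _) → ¬uv (e , p∉ , q∉)
            ; (there i) e fp fq → max i e fp fq }

  maximalMatching : ∀ R → ∃[ L ] Valid R L × Maximal R L
  maximalMatching R with greedy (cartesianProduct (allFin n) (allFin n)) R
  ... | L , val , max = L , val , max (∈-cartesianProduct⁺ (∈-allFin _) (∈-allFin _))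

  valid-++ : ∀ {R L M} → Valid R L → Valid (cov L ++ R) M → Valid R (L ++ M)
  valid-++ [] val′ = val′
  valid-++ {R} (add {u} {v} {L} uv u∉ v∉ val) val′ = add uv u∉ v∉ (valid-++ val (valid-⊆ sub val′))
    where
    sub : cov L ++ u ∷ v ∷ R ⊆ u ∷ v ∷ cov L ++ R
    sub i with ∈-++⁻ (cov L) i
    ... | inj₁ p                 = there (there (∈-++⁺ˡ p))
    ... | inj₂ (here p)          = here p
    ... | inj₂ (there (here p))  = there (here p)
    ... | inj₂ (there (there p)) = there (there (∈-++⁺ʳ (cov L) p))

  free-++ : ∀ {R} L {M p} → Free R (L ++ M) p → Free (cov L ++ R) M p
  free-++ L {M} (p∉R , p∉) =
    (λ i → [ (λ j → p∉ (subst (_ ∈_) (sym (cov-++ L M)) (∈-++⁺ˡ j))) , p∉R ] (∈-++⁻ (cov L) i)) ,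
    (λ i → p∉ (subst (_ ∈_) (sym (cov-++ L M)) (∈-++⁺ʳ (cov L) i)))

  maximal-++ : ∀ {R} L {M} → Maximal (cov L ++ R) M → Maximal R (L ++ M)
  maximal-++ L max e fp fq = max e (free-++ L fp) (free-++ L fq)

  record Mate (R : List V) (L : List (V × V)) (v : V) : Set where
    field
      mate   : V
      rest   : List (V × V)
      v~mate : v ~ mate
      v∉     : v ∉ R
      mate∉  : mate ∉ R
      valid  : Valid (v ∷ mate ∷ R) rest
      len    : length L ≡ suc (length rest)
      ⊆cov   : v ∷ mate ∷ cov rest ⊆ cov L
      cov⊆   : cov L ⊆ v ∷ mate ∷ cov rest

  removeMate : ∀ {R L v} → Valid R L → v ∈ cov L → Mate R L v
  removeMate (add uv u∉ v∉ val) (here refl) = record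
    { v~mate = uv ; v∉ = u∉ ; mate∉ = v∉ ; valid = val ; len = refl ; ⊆cov = id ; cov⊆ = id }
  removeMate (add uv u∉ v∉ val) (there (here refl)) = record
    { v~mate = ~-sym uv ; v∉ = v∉ ; mate∉ = u∉ ; valid = valid-⊆ pull₁ val ; len = refl ; ⊆cov = pull₁ ; cov⊆ = pull₁ }
  removeMate {R} {(a , b) ∷ L} {v} (add ab a∉ b∉ val) (there (there i)) = record
    { mate = mate ; rest = (a , b) ∷ rest ; v~mate = v~mate
    ; v∉ = λ p → v∉ (there (there p)) ; mate∉ = λ p → mate∉ (there (there p))
    ; valid = add ab
        ((λ p → v∉ (here (sym p))) ∉∷ (λ p → mate∉ (here (sym p))) ∉∷ a∉)
        ((λ p → v∉ (there (here (sym p)))) ∉∷ (λ p → mate∉ (there (here (sym p)))) ∉∷ b∉)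
        (valid-⊆ block valid)
    ; len = cong suc len
    ; ⊆cov = λ p → cons-⊆ (cons-⊆ ⊆cov) (block p)
    ; cov⊆ = λ p → block (cons-⊆ (cons-⊆ cov⊆) p) }
    where
    open Mate (removeMate val i)
    block : ∀ {a b c d : V} {R} → a ∷ b ∷ c ∷ d ∷ R ⊆ c ∷ d ∷ a ∷ b ∷ R
    block (here p)                          = there (there (here p))
    block (there (here p))                  = there (there (there (here p)))
    block (there (there (here p)))          = here p
    block (there (there (there (here p))))  = there (here p)
    block (there (there (there (there p)))) = there (there (there (there p)))

  toSet : List (V × V) → EdgeSet n
  toSet []            = ∅
  toSet ((u , v) ∷ L) = insert u v (toSet L)

  maximal-shift : ∀ {R u v L} → Maximal R ((u , v) ∷ L) → Maximal (u ∷ v ∷ R) L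
  maximal-shift {R} {u} {v} {L} max e fp fq = max e (shift fp) (shift fq)
    where
    shift : ∀ {p} → Free (u ∷ v ∷ R) L p → Free R ((u , v) ∷ L) p
    shift (p∉ , p∉L) = (p∉ ∘ there ∘ there) , ((p∉ ∘ here) ∉∷ (p∉ ∘ there ∘ here) ∉∷ p∉L)

  matching-good : ∀ {R L} → Valid R L → Maximal R L → Good R (toSet L)
  matching-good {R} [] max = record
    { dominating = record { symm = λ _ _ → refl ; edge = λ () ; avoid = λ ()
                          ; dom = λ e u∉ v∉ → ⊥-elim (max e (u∉ , λ ()) (v∉ , λ ())) }
    ; priv = λ () }
  matching-good (add uv u∉ v∉ val) max = insert-good uv u∉ v∉ (matching-good val (maximal-shift max))

  size-matching : ∀ {R L} → Valid R L → Maximal R L → size (toSet L) ≡ length L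
  size-matching [] max = size-∅ n
  size-matching (add uv u∉ v∉ val) max =
    trans (size-insert-good uv (matching-good val (maximal-shift max))) (cong suc (size-matching val (maximal-shift max)))

  touches-cov : ∀ L {u v} → toSet L u v ≡ true → u ∈ cov L
  touches-cov ((a , b) ∷ L) p with insert⁻ {S = toSet L} p
  ... | inj₁ (inj₁ (refl , _)) = here refl
  ... | inj₁ (inj₂ (refl , _)) = there (here refl)
  ... | inj₂ q                 = there (there (touches-cov L q))

  Equimatchable : List V → ℕ → Set
  Equimatchable R t = ∀ {L} → Valid R L → Maximal R L → length L ≡ t

  module _ {R t} (eqm : Equimatchable R t) where

    matching-≤ : ∀ {L} → Valid R L → length L ≤ t
    matching-≤ {L} val with maximalMatching (cov L ++ R)
    ... | M , valM , maxM = subst (length L ≤_)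
            (trans (sym (List.length-++ L)) (eqm (valid-++ val valM) (maximal-++ L maxM))) (ℕ.m≤m+n _ _)

    -- A maximal extension of L has t edges, so its added part is nonempty, and the first added edge
    -- has both ends free.
    enlarge : ∀ {L} → Valid R L → length L < t → ∃[ p ] ∃[ q ] p ~ q × Free R L p × Free R L q
    enlarge {L} val lt with maximalMatching (cov L ++ R)
    ... | [] , valM , maxM = ⊥-elim (ℕ.<⇒≢ lt
            (trans (cong length (sym (List.++-identityʳ L))) (eqm (valid-++ val valM) (maximal-++ L maxM))))
    ... | (p , q) ∷ _ , add e p∉ q∉ _ , _ = p , q , e , split p∉ , split q∉
      where
      split : ∀ {p} → p ∉ cov L ++ R → Free R L p
      split p∉ = (λ i → p∉ (∈-++⁺ʳ (cov L) i)) , (λ i → p∉ (∈-++⁺ˡ i))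

  free-shift : ∀ {R u v L p} → Free R ((u , v) ∷ L) p → Free (u ∷ v ∷ R) L p
  free-shift (p∉ , p∉L) = ((p∉L ∘ here) ∉∷ (p∉L ∘ there ∘ here) ∉∷ p∉) , (p∉L ∘ there ∘ there)

  equimatchable-step : ∀ {R t u v} → u ~ v → u ∉ R → v ∉ R → Equimatchable R (suc t) → Equimatchable (u ∷ v ∷ R) t
  equimatchable-step uv u∉ v∉ eqm val max =
    ℕ.suc-injective (eqm (add uv u∉ v∉ val) λ e fp fq → max e (free-shift fp) (free-shift fq))

  module _ (wed : WellEdgeDominated G) where

    good-size : ∀ {S T} → Good [] S → Good [] T → size S ≡ size T
    good-size gS gT = wed _ _ (good⇒minimal gS) (good⇒minimal gT)

    matchingNumber : ℕ
    matchingNumber = length (proj₁ (maximalMatching []))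

    good-number : ∀ {S} → Good [] S → size S ≡ matchingNumber
    good-number g = let L , val , max = maximalMatching [] in
      trans (good-size g (matching-good val max)) (size-matching val max)

    equimatchable : Equimatchable [] matchingNumber
    equimatchable val max = trans (sym (size-matching val max)) (good-number (matching-good val max))

data Distinct {A : Set} : List A → Set where
  []  : Distinct []
  _∷_ : ∀ {x xs} → x ∉ xs → Distinct xs → Distinct (x ∷ xs)

lookup-injective : ∀ {A : Set} {xs : List A} → Distinct xs → ∀ {i j} → lookup xs i ≡ lookup xs j → i ≡ j
lookup-injective (_ ∷ _)  {zero}  {zero}  _  = refl
lookup-injective {xs = _ ∷ xs} (p ∷ _) {zero}  {suc j} eq = ⊥-elim (p (subst (_∈ xs) (sym eq) (∈-lookup j)))
lookup-injective {xs = _ ∷ xs} (p ∷ _) {suc i} {zero}  eq = ⊥-elim (p (subst (_∈ xs) eq (∈-lookup i)))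
lookup-injective (_ ∷ d)  {suc i} {suc j} eq = cong suc (lookup-injective d eq)

-- Completing matchings across the triangle.

module Triangles {n} (G : Graph n) where
  open Domination G

  -- Vertices named by their positions in a distinct list, so that the freshness
  -- side conditions of a matching are decided by computation on positions.
  module Named (xs : List V) (d : Distinct xs) where

    I : Set
    I = Fin (length xs)

    f : I → V
    f = lookup xs

    names : List I → List V
    names = map f

    edges : List (I × I) → List (V × V)
    edges = map λ (i , j) → f i , f j

    others : List I → List I
    others is = filter (_∉? is) (allFin _)

    OK : List (I × I) → List I → Set
    OK [] is             = ⊤
    OK ((i , j) ∷ es) is = True (i ∉? is) × True (j ∉? is) × OK es (i ∷ j ∷ is)

    Edges : List (I × I) → Set
    Edges []             = ⊤
    Edges ((i , j) ∷ es) = f i ~ f j × Edges es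

    fresh : ∀ i is {_ : True (i ∉? is)} → f i ∉ names is
    fresh i is {t} p with ∈-map⁻ f p
    ... | j , j∈ , eq = toWitness t (subst (_∈ is) (sym (lookup-injective d eq)) j∈)

    distinct-at : ∀ i j {_ : True (¬? (i ≟ j))} → f i ≢ f j
    distinct-at i j {t} = toWitness t ∘ lookup-injective d

    names-⊆ : ∀ is → names is ⊆ xs
    names-⊆ is p with ∈-map⁻ f p
    ... | j , _ , refl = ∈-lookup j

    build : ∀ {L} es is {_ : OK es is} → Edges es → Valid xs L → Valid (names is) (edges es ++ L)
    build [] is _ val = valid-⊆ (names-⊆ is) val
    build ((i , j) ∷ es) is {ti , tj , ok} (e , rest) val =
      add e (fresh i is {ti}) (fresh j is {tj}) (build es (i ∷ j ∷ is) {ok} rest val)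

    edges-cov : ∀ {L} es i → i ∈ cov es → f i ∈ cov (edges es ++ L)
    edges-cov (_ ∷ es) i (here refl)         = here refl
    edges-cov (_ ∷ es) i (there (here refl)) = there (here refl)
    edges-cov (_ ∷ es) i (there (there p))   = there (there (edges-cov es i p))

    uncovered : ∀ {L} es i {_ : True (i ∉? cov es)} → Valid xs L → f i ∉ cov (edges es ++ L)
    uncovered es i {t} val = go es (toWitness t)
      where
      go : ∀ es → i ∉ cov es → f i ∉ cov (edges es ++ _)
      go [] _ = disjoint val (∈-lookup i)
      go ((a , b) ∷ es) i∉ =
        (i∉ ∘ here ∘ lookup-injective d) ∉∷ (i∉ ∘ there ∘ here ∘ lookup-injective d) ∉∷ go es (i∉ ∘ there ∘ there)

    old-cov : ∀ {L} es {p} → p ∈ cov L → p ∈ cov (edges es ++ L)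
    old-cov [] i       = i
    old-cov (_ ∷ es) i = there (there (old-cov es i))

    leftover : ∀ {L p} es is → Free (names is) (edges es ++ L) p →
               p ∈ names (others (is ++ cov es)) ⊎ Free xs L p
    leftover {L} {p} es is (p∉ , p∉L) with p ∈? xs
    ... | no p∉xs = inj₂ (p∉xs , (p∉L ∘ old-cov es))
    ... | yes p∈ with index p∈ | lookup-index p∈
    ...   | i | refl = inj₁ (∈-map⁺ f (∈-filter⁺ (_∉? (is ++ cov es)) (∈-allFin i) λ i∈ →
              [ p∉ ∘ ∈-map⁺ f , p∉L ∘ edges-cov es i ] (∈-++⁻ is i∈)))

  add-free : ∀ {R L u v} → u ~ v → Free R L u → Free R L v → Valid R L → Valid R ((u , v) ∷ L)
  add-free uv (u∉ , u∉L) (v∉ , v∉L) val = add uv u∉ v∉ (valid-avoid (valid-avoid val v∉L) u∉L)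

  free-tail : ∀ {R L a p} → Free (a ∷ R) L p → Free R L p
  free-tail (p∉ , p∉L) = (p∉ ∘ there) , p∉L

  record Triangle (x y z : V) : Set where
    field
      xy   : x ~ y
      xz   : x ~ z
      yz   : y ~ z
      only : ∀ a b c → a ~ b → b ~ c → a ~ c → OneOf3 x y z a × OneOf3 x y z b × OneOf3 x y z c

    corners : List V
    corners = x ∷ y ∷ z ∷ []

    distinct : Distinct corners
    distinct = (~⇒≢ xy ∉∷ ~⇒≢ xz ∉∷ λ ()) ∷ (~⇒≢ yz ∉∷ λ ()) ∷ (λ ()) ∷ []

    no-triangle : ∀ {a b c} → a ∉ corners → a ~ b → b ~ c → a ~ c → ⊥
    no-triangle {a} {b} {c} a∉ ab bc ac with proj₁ (only a b c ab bc ac)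
    ... | inj₁ p        = a∉ (here p)
    ... | inj₂ (inj₁ p) = a∉ (there (here p))
    ... | inj₂ (inj₂ p) = a∉ (there (there (here p)))

    private-neighbours : ∀ {v} → v ∉ corners → x ~ v → y ~ v → ⊥
    private-neighbours v∉ xv yv = no-triangle v∉ (~-sym xv) xy (~-sym yv)

    distinct₆ : ∀ {k m l} → x ~ k → y ~ m → z ~ l → k ∉ corners → m ∉ corners → l ∉ corners →
                Distinct (l ∷ m ∷ k ∷ corners)
    distinct₆ xk ym zl k∉ m∉ l∉ =
      ((λ { refl → no-triangle l∉ (~-sym ym) yz (~-sym zl) }) ∉∷
       (λ { refl → no-triangle l∉ (~-sym xk) xz (~-sym zl) }) ∉∷ l∉) ∷
      ((λ { refl → private-neighbours m∉ xk ym }) ∉∷ m∉) ∷ k∉ ∷ distinct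

  swap-triangle : ∀ {x y z} → Triangle x y z → Triangle y x z
  swap-triangle t = record { xy = ~-sym t.xy ; xz = t.yz ; yz = t.xz ; only = λ a b c p q r →
    let i , j , k = t.only a b c p q r in swap i , swap j , swap k }
    where
    module t = Triangle t
    swap : ∀ {a x y z} → OneOf3 {n} x y z a → OneOf3 y x z a
    swap (inj₁ p)        = inj₂ (inj₁ p)
    swap (inj₂ (inj₁ p)) = inj₁ p
    swap (inj₂ (inj₂ p)) = inj₂ (inj₂ p)

  rotate-triangle : ∀ {x y z} → Triangle x y z → Triangle y z x
  rotate-triangle t = record { xy = t.yz ; xz = ~-sym t.xy ; yz = ~-sym t.xz ; only = λ a b c p q r →
    let i , j , k = t.only a b c p q r in rotate i , rotate j , rotate k }
    where
    module t = Triangle t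
    rotate : ∀ {a x y z} → OneOf3 {n} x y z a → OneOf3 y z x a
    rotate (inj₁ p)        = inj₂ (inj₂ p)
    rotate (inj₂ (inj₁ p)) = inj₁ p
    rotate (inj₂ (inj₂ p)) = inj₂ (inj₁ p)

  swap₃ : ∀ {x y z : V} → y ∷ x ∷ z ∷ [] ⊆ x ∷ y ∷ z ∷ []
  swap₃ = pull₁

  rotate₃ : ∀ {x y z : V} → y ∷ z ∷ x ∷ [] ⊆ x ∷ y ∷ z ∷ []
  rotate₃ (here p)                 = there (here p)
  rotate₃ (there (here p))         = there (there (here p))
  rotate₃ (there (there (here p))) = here p

  maximal-⊆ : ∀ {R R′ L} → R ⊆ R′ → Maximal R L → Maximal R′ L
  maximal-⊆ s max e (p∉ , p∉L) (q∉ , q∉L) = max e (p∉ ∘ s , p∉L) (q∉ ∘ s , q∉L)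

  module _ {h : ℕ} (eqm : Equimatchable [] (suc h)) where

    private
      -- Once xy is added only z remains of the corners, and no neighbour of z is free.
      one-edge : ∀ {x y z} → Triangle x y z → ∀ {L} → Valid (x ∷ y ∷ z ∷ []) L → Maximal (x ∷ y ∷ z ∷ []) L →
                 (∀ {l} → z ~ l → ¬ Free (x ∷ y ∷ z ∷ []) L l) → 1 + length L ≡ suc h
      one-edge {x} {y} {z} T val max none = eqm (N.build es [] (T.xy , tt) val) λ e fp fq →
        case N.leftover es [] fp , N.leftover es [] fq of λ
          { (inj₁ (here refl) , inj₁ (here refl)) → ~⇒≢ e refl
          ; (inj₁ (here refl) , inj₂ fq)          → none e fq
          ; (inj₂ fp , inj₁ (here refl))          → none (~-sym e) fp
          ; (inj₂ fp , inj₂ fq)                   → max e fp fq }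
        where
        module T = Triangle T
        module N = Named (x ∷ y ∷ z ∷ []) T.distinct
        es = (0F , 1F) ∷ []

      two-edges : ∀ {x y z} → Triangle x y z → ∀ {L k} → Valid (x ∷ y ∷ z ∷ []) L → Maximal (x ∷ y ∷ z ∷ []) L →
                  x ~ k → Free (x ∷ y ∷ z ∷ []) L k → 2 + length L ≡ suc h
      two-edges {x} {y} {z} T {L} {k} val max xk (k∉ , k∉L) =
        eqm (N.build es [] (xk , T.yz , tt) (valid-avoid val k∉L)) λ e fp fq →
          case N.leftover es [] fp , N.leftover es [] fq of λ
            { (inj₂ fp , inj₂ fq) → max e (free-tail fp) (free-tail fq) }
        where
        module T = Triangle T
        module N = Named (k ∷ x ∷ y ∷ z ∷ []) (k∉ ∷ T.distinct)
        es = (1F , 0F) ∷ (2F , 3F) ∷ []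

      three-edges : ∀ {x y z} → Triangle x y z → ∀ {L k m l} → Valid (x ∷ y ∷ z ∷ []) L → Maximal (x ∷ y ∷ z ∷ []) L →
                    x ~ k → y ~ m → z ~ l →
                    Free (x ∷ y ∷ z ∷ []) L k → Free (x ∷ y ∷ z ∷ []) L m → Free (x ∷ y ∷ z ∷ []) L l →
                    3 + length L ≡ suc h
      three-edges {x} {y} {z} T {L} {k} {m} {l} val max xk ym zl (k∉ , k∉L) (m∉ , m∉L) (l∉ , l∉L) =
        eqm (N.build es [] (xk , ym , zl , tt) (valid-avoid (valid-avoid (valid-avoid val k∉L) m∉L) l∉L)) λ e fp fq →
          case N.leftover es [] fp , N.leftover es [] fq of λ
            { (inj₂ fp , inj₂ fq) → max e (free-tail (free-tail (free-tail fp))) (free-tail (free-tail (free-tail fq))) }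
        where
        module T = Triangle T
        module N = Named (l ∷ m ∷ k ∷ x ∷ y ∷ z ∷ []) (T.distinct₆ xk ym zl k∉ m∉ l∉)
        es = (3F , 2F) ∷ (4F , 1F) ∷ (5F , 0F) ∷ []

    -- If a maximal matching L of G - {x,y,z} misses a neighbour of x, then xk and yz
    -- complete it to a maximal matching of G.  Comparing with the completion by xz alone, L also
    -- misses a neighbour of y, and likewise one of z; but then three edges can be added.
    none-missed : ∀ {x y z} → Triangle x y z → ∀ {L k} → Valid (x ∷ y ∷ z ∷ []) L → Maximal (x ∷ y ∷ z ∷ []) L →
                  x ~ k → ¬ Free (x ∷ y ∷ z ∷ []) L k
    none-missed {x} {y} {z} T {L} {k} val max xk fk
      with any? (λ m → (y ~? m) ×-dec ((m ∉? T.corners) ×-dec (m ∉? cov L)))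
         | any? (λ l → (z ~? l) ×-dec ((l ∉? T.corners) ×-dec (l ∉? cov L)))
      where module T = Triangle T
    ... | yes (m , ym , fm) | yes (l , zl , fl) =
      ℕ.<⇒≢ (ℕ.n<1+n _) (trans (two-edges T val max xk fk) (sym (three-edges T val max xk ym zl fk fm fl)))
    ... | _ | no none = ℕ.<⇒≢ (ℕ.n<1+n _) (trans (one-edge T val max λ zl fl → none (_ , zl , fl)) (sym (two-edges T val max xk fk)))
    -- After two rotations the single edge is zx, and y is the corner left over.
    ... | no none | _ = ℕ.<⇒≢ (ℕ.n<1+n _) (trans
            (one-edge (rotate-triangle (rotate-triangle T)) (valid-⊆ (rotate₃ ∘ rotate₃) val)
              (maximal-⊆ rotate₃ max) λ ym (m∉ , m∉L) → none (_ , ym , (m∉ ∘ rotate₃ ∘ rotate₃ ∘ rotate₃ ∘ rotate₃ , m∉L)))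
            (sym (two-edges T val max xk fk)))

    module Corner {x y z : V} (T : Triangle x y z) where
      open Triangle T public

      Attached : V → Set
      Attached v = (x ~ v ⊎ y ~ v ⊎ z ~ v) × v ∉ corners

      attached-covered : ∀ {L v} → Valid corners L → Maximal corners L → Attached v → v ∈ cov L
      attached-covered {L} {v} val max (a , v∉) with v ∈? cov L
      ... | yes v∈ = v∈
      ... | no v∉L with a
      ...   | inj₁ xv        = ⊥-elim (none-missed T val max xv (v∉ , v∉L))
      ...   | inj₂ (inj₁ yv) = ⊥-elim (none-missed (rotate-triangle T) (valid-⊆ rotate₃ val)
                                 (maximal-⊆ (rotate₃ ∘ rotate₃) max) yv (v∉ ∘ rotate₃ , v∉L))
      ...   | inj₂ (inj₂ zv) = ⊥-elim (none-missed (rotate-triangle (rotate-triangle T)) (valid-⊆ (rotate₃ ∘ rotate₃) val)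
                                 (maximal-⊆ rotate₃ max) zv (v∉ ∘ rotate₃ ∘ rotate₃ , v∉L))

      -- A maximal matching of H covers the neighbours of z, so the single edge xy already makes it
      -- maximal in G.
      equimatchable-corners : Equimatchable corners h
      equimatchable-corners val max = ℕ.suc-injective
        (one-edge T val max λ zl (l∉ , l∉L) → l∉L (attached-covered val max (inj₂ (inj₂ zl) , l∉)))

      -- A maximal extension of L in H covers v, necessarily by an edge outside L.
      attached-mate : ∀ {L v} → Valid corners L → Attached v → v ∉ cov L → ∃[ v′ ] v ~ v′ × Free corners L v′
      attached-mate {L} {v} val a v∉L with maximalMatching (cov L ++ corners)
      ... | M , valM , maxM with ∈-++⁻ (cov L) (subst (v ∈_) (cov-++ L M)
                                   (attached-covered (valid-++ val valM) (maximal-++ L maxM) a))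
      ...   | inj₁ p = ⊥-elim (v∉L p)
      ...   | inj₂ p = mate , v~mate , (mate∉ ∘ ∈-++⁺ʳ (cov L)) , (mate∉ ∘ ∈-++⁺ˡ)
        where open Mate (removeMate valM p)

      -- An uncovered v could be matched by `attached-mate`, giving h + 1 edges in H.
      large-covers : ∀ {L v} → Valid corners L → length L ≡ h → Attached v → v ∈ cov L
      large-covers {L} {v} val len a with v ∈? cov L
      ... | yes p = p
      ... | no p with attached-mate val a p
      ...   | v′ , e , f′ = ⊥-elim (ℕ.<⇒≱ (ℕ.n<1+n h)
                (subst (λ t → suc t ≤ h) len (matching-≤ equimatchable-corners (add-free e (proj₂ a , p) f′ val))))

      -- Completing L by xk, ym, zl gives 3 + |L| = h + 1. If k, m, l are pairwise nonadjacent,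
      -- `attached-mate` matches them one after another inside H without using up the others, and L
      -- grows to h + 1 edges in H.
      some-adjacent : ∀ {k m l} → x ~ k → y ~ m → z ~ l → k ∉ corners → m ∉ corners → l ∉ corners →
                      ¬ k ~ m → ¬ k ~ l → ¬ m ~ l → ⊥
      some-adjacent {k} {m} {l} xk ym zl k∉ m∉ l∉ km kl ml with maximalMatching (l ∷ m ∷ k ∷ corners)
      ... | L , val , max = contradict (attached-mate val₀ (inj₁ xk , k∉) k∉L)
        where
        module N = Named (l ∷ m ∷ k ∷ corners) (distinct₆ xk ym zl k∉ m∉ l∉)
        es = (3F , 2F) ∷ (4F , 1F) ∷ (5F , 0F) ∷ []
        val₀ : Valid corners L
        val₀ = valid-⊆ (λ i → there (there (there i))) val
        l∉L : l ∉ cov L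
        l∉L = disjoint val (here refl)
        m∉L : m ∉ cov L
        m∉L = disjoint val (there (here refl))
        k∉L : k ∉ cov L
        k∉L = disjoint val (there (there (here refl)))
        three : 3 + length L ≡ suc h
        three = eqm (N.build es [] (xk , ym , zl , tt) val) λ e fp fq →
          case N.leftover es [] fp , N.leftover es [] fq of λ { (inj₂ fp , inj₂ fq) → max e fp fq }
        contradict : (∃[ k′ ] k ~ k′ × Free corners L k′) → ⊥
        contradict (k′ , kk′ , fk′) = case attached-mate val₁ (inj₂ (inj₁ ym) , m∉) m∉₁ of λ
          { (m′ , mm′ , fm′) →
            let val₂ = add-free mm′ (m∉ , m∉₁) fm′ val₁
                l∉₂ = (N.distinct-at 0F 1F) ∉∷ (λ { refl → ml mm′ }) ∉∷ l∉₁
            in case attached-mate val₂ (inj₂ (inj₂ zl) , l∉) l∉₂ of λ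
              { (l′ , ll′ , fl′) → ℕ.<⇒≱ (ℕ.≤-reflexive (sym three))
                  (matching-≤ equimatchable-corners (add-free ll′ (l∉ , l∉₂) fl′ val₂)) } }
          where
          val₁ : Valid corners ((k , k′) ∷ L)
          val₁ = add-free kk′ (k∉ , k∉L) fk′ val₀
          m∉₁ : m ∉ cov ((k , k′) ∷ L)
          m∉₁ = (N.distinct-at 1F 2F) ∉∷ (λ { refl → km kk′ }) ∉∷ m∉L
          l∉₁ : l ∉ cov ((k , k′) ∷ L)
          l∉₁ = (N.distinct-at 0F 2F) ∉∷ (λ { refl → kl kk′ }) ∉∷ l∉L

-- Comprehension under double negation, and walks.

¬¬-decide : ∀ {n} (P : Fin n → Set) → ¬ ¬ (∀ i → Dec (P i))
¬¬-decide {zero}  P k = k λ ()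
¬¬-decide {suc n} P k = ¬¬-decide (P ∘ suc) λ d →
  let decided d₀ = k λ { zero → d₀ ; (suc i) → d i } in decided (no λ p → decided (yes p))

-- Makes an undecided predicate on vertices Boolean wherever the goal is absurd or decidable.
¬¬-comprehension : ∀ {n} (P : Fin n → Set) →
  ¬ ¬ (∃[ b ] ∀ i → (b i ≡ true → P i) × (P i → b i ≡ true))
¬¬-comprehension P k = ¬¬-decide P λ d → k ((λ i → does (d i)) , λ i → does⁻ (d i) , dec-true (d i))

module _ {n} {G : Graph n} {P : Fin n → Set} where

  walk-end : ∀ {u v} → Walk G P u v → P v
  walk-end (Walk.here p)     = p
  walk-end (Walk.step _ _ w) = walk-end w

  walk-trans : ∀ {u v w} → Walk G P u v → Walk G P v w → Walk G P u w
  walk-trans (Walk.here _)     w′ = w′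
  walk-trans (Walk.step p e w) w′ = Walk.step p e (walk-trans w w′)

  walk-snoc : ∀ {u v w} → Walk G P u v → adj G v w ≡ true → P w → Walk G P u w
  walk-snoc w e p = walk-trans w (Walk.step (walk-end w) e (Walk.here p))

  walk-reverse : ∀ {u v} → Walk G P u v → Walk G P v u
  walk-reverse (Walk.here p)     = Walk.here p
  walk-reverse (Walk.step {u} {v} p e w) = walk-snoc (walk-reverse w) (trans (Graph.sym G v u) e) p

-- Singling out one corner by the component hypotheses.

module Separation {n} (G : Graph n) where
  open Domination G
  open Triangles G

  -- A union of components of G - C.
  record Region (C : List V) (K : V → Bool) : Set where
    field
      inside : ∀ {u} → K u ≡ true → u ∉ C
      closed : ∀ {u v} → K u ≡ true → u ~ v → v ∉ C → K v ≡ true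

  -- What the component hypothesis for the edge pq provides: a part of G - C seen from p or q but
  -- not from s.
  Detached : List V → V → V → V → (V → Bool) → Set
  Detached C p q s K = Region C K × (∀ {u} → K u ≡ true → ¬ s ~ u) ×
    ∃[ u ] K u ≡ true × (p ~ u ⊎ q ~ u)

  -- This marks s as the corner at which the house will be glued. In contrast, `Detached` promises
  -- only one neighbour of p or q inside K.
  Separated : List V → V → V → V → (V → Bool) → Set
  Separated C p q s K = Region C K × (∀ {u} → p ~ u → u ∉ C → K u ≡ true) ×
    (∀ {u} → q ~ u → u ∉ C → K u ≡ true) × (∀ {u} → s ~ u → u ∉ C → K u ≢ true)

  -- At most one of the two components of G - {x,y} contains z. The other is not adjacent to z, and
  -- a walk from it to x must leave it through x or y.
  detached : Connected G → ∀ {x y z C} → z ≢ x → z ≢ y → (∀ {v} → v ∈ C → v ≡ x ⊎ v ≡ y ⊎ v ≡ z) →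
             (∀ {v} → v ≡ x ⊎ v ≡ y ⊎ v ≡ z → v ∈ C) →
             TwoNontrivialComponents G x y → ¬ ¬ (∃[ K ] Detached C x y z K)
  detached conn {x} {y} {z} {C} z≢x z≢y C⁻ C⁺ (a , _ , c , _ , Pa , _ , Pc , _ , _ , _ , sep) k =
    ¬¬-comprehension (Walk G _ a) λ (A , A⇔) → ¬¬-comprehension (Walk G _ c) λ (B , B⇔) →
      case A z Bool.≟ true of λ
        { (no ¬Az)  → k (A , component Pa A⇔ λ w → ¬Az (proj₂ (A⇔ z) w))
        ; (yes Az) → k (B , component Pc B⇔ λ w → sep (walk-trans (proj₁ (A⇔ z) Az) (walk-reverse w))) }
    where
    P : V → Set
    P w = (w ≢ x) × (w ≢ y)
    component : ∀ {a K} → P a → (∀ i → (K i ≡ true → Walk G P a i) × (Walk G P a i → K i ≡ true)) →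
                ¬ Walk G P a z → Detached C x y z K
    component {a} {K} Pa K⇔ ¬az = region , (λ {u} Ku zu → ¬az (walk-snoc (proj₁ (K⇔ u) Ku) (~-sym zu) Pz)) ,
        attach (conn a x) (proj₂ (K⇔ a) (Walk.here Pa)) (λ Kx → Region.inside region Kx (C⁺ (inj₁ refl)))
      where
      Pz : P z
      Pz = z≢x , z≢y
      region : Region C K
      region = record
        { inside = λ {u} Ku u∈ → let p , q = walk-end (proj₁ (K⇔ u) Ku) in
            case C⁻ u∈ of λ { (inj₁ e) → p e ; (inj₂ (inj₁ e)) → q e ; (inj₂ (inj₂ refl)) → ¬az (proj₁ (K⇔ u) Ku) }
        ; closed = λ {u} {v} Ku e v∉ → proj₂ (K⇔ v) (walk-snoc (proj₁ (K⇔ u) Ku) e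
            ((λ p → v∉ (C⁺ (inj₁ p))) , (λ p → v∉ (C⁺ (inj₂ (inj₁ p)))))) }
      attach : ∀ {u v} → Walk G (λ _ → ⊤) u v → K u ≡ true → K v ≢ true → ∃[ u ] K u ≡ true × (x ~ u ⊎ y ~ u)
      attach (Walk.here _) Ku ¬Kv = ⊥-elim (¬Kv Ku)
      attach (Walk.step {u} {v} _ e w) Ku ¬Kv with K v Bool.≟ true
      ... | yes Kv = attach w Kv ¬Kv
      ... | no ¬Kw with v ∈? C
      ...   | no v∉ = ⊥-elim (¬Kw (Region.closed region Ku e v∉))
      ...   | yes v∈ with C⁻ v∈
      ...     | inj₁ refl        = u , Ku , inj₁ (~-sym e)
      ...     | inj₂ (inj₁ refl) = u , Ku , inj₂ (~-sym e)
      ...     | inj₂ (inj₂ refl) = ⊥-elim (¬az (walk-snoc (proj₁ (K⇔ u) Ku) e Pz))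

  module _ {C : List V} where

    Triple : V → V → V → Set
    Triple x y z = ∀ {k m l} → x ~ k → y ~ m → z ~ l → k ∉ C → m ∉ C → l ∉ C → ¬ k ~ m → ¬ k ~ l → ¬ m ~ l → ⊥

    swap-triple : ∀ {x y z} → Triple x y z → Triple y x z
    swap-triple t yk xm zl k∉ m∉ l∉ km kl ml = t xm yk zl m∉ k∉ l∉ (km ∘ ~-sym) ml kl

    -- As `Kz` is closed and sees no neighbour of z, k is adjacent neither to m nor to l. So
    -- `Triple` makes every y-neighbour outside `Kz` adjacent to every z-neighbour, and these
    -- vertices hang together; it remains to place them in `Kx`.
    separate-crossing : ∀ {x y z Kx Ky Kz k m l} → Triple x y z →
      Detached C y z x Kx → Detached C x z y Ky → Detached C x y z Kz →
      x ~ k → Kz k ≡ true → y ~ m → m ∉ C → Kz m ≢ true → z ~ l → l ∉ C → Separated C y z x Kx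
    separate-crossing {x} {y} {z} {Kx} {Ky} {Kz} {k} {m} {l} triple (rx , ¬x , attx) (ry , ¬y , atty) (rz , ¬z , _)
      xk Kzk ym m∉ ¬Kzm zl l∉ =
      rx , (λ {u} yu u∉ → Kx-closed (~-sym (m~l yu u∉ (λ Kzu → no-y yu Kzu) zl l∉)) (Kxl zl l∉) u∉) ,
      (λ {u} zu u∉ → Kxl zu u∉) , λ xu _ Kxu → ¬x Kxu xu
      where
      module rx = Region rx
      module ry = Region ry
      module rz = Region rz
      Kx-closed : ∀ {u v} → u ~ v → Kx u ≡ true → v ∉ C → Kx v ≡ true
      Kx-closed e p q = rx.closed p e q
      k∉ : k ∉ C
      k∉ = rz.inside Kzk
      outsideKz : ∀ {u l} → Kz u ≡ true → z ~ l → l ∉ C → ¬ u ~ l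
      outsideKz Kzu zl l∉ ul = ¬z (rz.closed Kzu ul l∉) zl
      m~l : ∀ {m l} → y ~ m → m ∉ C → Kz m ≢ true → z ~ l → l ∉ C → m ~ l
      m~l {m} {l} ym m∉ ¬Kzm zl l∉ = decidable-stable (m ~? l)
        (triple xk ym zl k∉ m∉ l∉ (λ km → ¬Kzm (rz.closed Kzk km m∉)) (outsideKz Kzk zl l∉))
      -- `Kx` contains a neighbour u of y or z. If u lies in `Kz`, then k, u and `l′` are pairwise
      -- nonadjacent; otherwise the forced adjacencies lead from u to `l′` inside `Kx`.
      Kxl : ∀ {l} → z ~ l → l ∉ C → Kx l ≡ true
      Kxl {l′} zl′ l′∉ = from attx
        where
        from : (∃[ u ] Kx u ≡ true × (y ~ u ⊎ z ~ u)) → Kx l′ ≡ true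
        from (u , Kxu , inj₂ zu) = rx.closed (rx.closed Kxu (~-sym (m~l ym m∉ ¬Kzm zu (rx.inside Kxu))) m∉)
                                  (m~l ym m∉ ¬Kzm zl′ l′∉) l′∉
        from (u , Kxu , inj₁ yu) with Kz u Bool.≟ true
        ... | no ¬Kzu = rx.closed Kxu (m~l yu (rx.inside Kxu) ¬Kzu zl′ l′∉) l′∉
        ... | yes Kzu = ⊥-elim (triple xk yu zl′ k∉ (rx.inside Kxu) l′∉ (λ ku → ¬x (rx.closed Kxu (~-sym ku) k∉) xk)
                          (outsideKz Kzk zl′ l′∉) (outsideKz Kzu zl′ l′∉))
      -- A y-neighbour in `Kz` leaves no place for `Ky`: a z-neighbour in `Ky` is adjacent to m, and
      -- an x-neighbour in `Ky` is part of a pairwise nonadjacent triple with `m₂` and l.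
      no-y : ∀ {u} → y ~ u → Kz u ≢ true
      no-y {m₂} ym₂ Kzm₂ = from atty
        where
        m₂∉ : m₂ ∉ C
        m₂∉ = rz.inside Kzm₂
        from : (∃[ u ] Ky u ≡ true × (x ~ u ⊎ z ~ u)) → ⊥
        from (u , Kyu , inj₂ zu) = ¬y (ry.closed Kyu (~-sym (m~l ym m∉ ¬Kzm zu (ry.inside Kyu))) m∉) ym
        from (u , Kyu , inj₁ xu) = triple xu ym₂ zl u∉ m₂∉ l∉ (λ um₂ → ¬y (ry.closed Kyu um₂ m₂∉) ym₂)
              (λ ul → ¬x (rx.closed (Kxl zl l∉) (~-sym ul) u∉) xu) (outsideKz Kzm₂ zl l∉)
          where
          u∉ : u ∉ C
          u∉ = ry.inside Kyu

    -- Either `Kz` contains all outer neighbours of x and y and separates z, or one of them escapes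
    -- while the other corner has a neighbour inside; that is the crossing case, up to exchanging x
    -- and y.
    separate-half : ∀ {x y z Kx Ky Kz k m l} → Triple x y z →
      Detached C y z x Kx → Detached C x z y Ky → Detached C x y z Kz →
      x ~ k → Kz k ≡ true → y ~ m → m ∉ C → z ~ l → l ∉ C →
      Separated C x y z Kz ⊎ Separated C y z x Kx ⊎ Separated C x z y Ky
    separate-half {x} {y} {z} {Kx} {Ky} {Kz} {k} {m} triple dx dy dz xk Kzk ym m∉ zl l∉
      with any? (λ m → (y ~? m) ×-dec ((m ∉? C) ×-dec ¬? (Kz m Bool.≟ true)))
         | any? (λ k → (x ~? k) ×-dec ((k ∉? C) ×-dec ¬? (Kz k Bool.≟ true)))
    ... | yes (m , ym , m∉ , ¬Kzm) | _ =
            inj₂ (inj₁ (separate-crossing triple dx dy dz xk Kzk ym m∉ ¬Kzm zl l∉))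
    ... | no none | no none′ = inj₁ (proj₁ dz ,
            (λ {u} xu u∉ → decidable-stable (Kz u Bool.≟ true) λ ne → none′ (u , xu , u∉ , ne)) ,
            (λ {u} yu u∉ → decidable-stable (Kz u Bool.≟ true) λ ne → none (u , yu , u∉ , ne)) ,
            λ zu _ Kzu → proj₁ (proj₂ dz) Kzu zu)
    ... | no none | yes (k′ , xk′ , k′∉ , ¬Kzk′) = inj₂ (inj₂
            (separate-crossing (swap-triple triple) dy dx (swap-detached dz) ym
              (decidable-stable (Kz m Bool.≟ true) λ ne → none (m , ym , m∉ , ne)) xk′ k′∉ ¬Kzk′ zl l∉))
      where
      swap-detached : ∀ {p q s K} → Detached C p q s K → Detached C q p s K
      swap-detached (r , ns , u , Ku , inj₁ e) = r , ns , u , Ku , inj₂ e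
      swap-detached (r , ns , u , Ku , inj₂ e) = r , ns , u , Ku , inj₁ e

    separate : ∀ {x y z Kx Ky Kz k m l} → Triple x y z →
      Detached C y z x Kx → Detached C x z y Ky → Detached C x y z Kz →
      x ~ k → k ∉ C → y ~ m → m ∉ C → z ~ l → l ∉ C →
      Separated C x y z Kz ⊎ Separated C y z x Kx ⊎ Separated C x z y Ky
    separate triple dx dy dz@(_ , _ , u , Kzu , inj₁ xu) xk k∉ ym m∉ zl l∉ =
      separate-half triple dx dy dz xu Kzu ym m∉ zl l∉
    separate triple dx dy (r , ¬z , u , Kzu , inj₂ yu) xk k∉ ym m∉ zl l∉
      with separate-half (swap-triple triple) dy dx (r , ¬z , u , Kzu , inj₁ yu) yu Kzu xk k∉ zl l∉
    ... | inj₁ (r , sy , sx , nz) = inj₁ (r , sx , sy , nz)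
    ... | inj₂ (inj₁ s)           = inj₂ (inj₂ s)
    ... | inj₂ (inj₂ s)           = inj₂ (inj₁ s)

-- The house has no further edges, and neighbours of z are covered.

module Tight {n} (G : Graph n) where
  open Domination G
  open Triangles G
  open Separation G

  ∉-++ : ∀ {A : Set} {p : A} {R R′} → p ∉ R → p ∉ R′ → p ∉ R ++ R′
  ∉-++ {R = R} p∉ p∉′ i = [ p∉ , p∉′ ] (∈-++⁻ R i)

  permute-good : ∀ {R R′ S} → R ⊆ R′ → R′ ⊆ R → Good R S → Good R′ S
  permute-good s s′ = rebase s′ (λ _ u∉ _ → u∉ ∘ s)

  module _ {h : ℕ} (eqm : Equimatchable [] (suc h)) (number : ∀ {S} → Good [] S → size S ≡ suc h)
           {x y z : V} (T : Triangle x y z) where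
    open Corner eqm T

    private
      module Nine {k m l w u l₀ : V}
        (d : Distinct (l₀ ∷ l ∷ m ∷ u ∷ k ∷ w ∷ corners))
        (xk : x ~ k) (ym : y ~ m) (zl : z ~ l) (km : k ~ m) (kw : k ~ w) (mu : m ~ u) (ll₀ : l ~ l₀)
        (l₀≁y : ¬ l₀ ~ y) (l₀≁w : ¬ l₀ ~ w) where

        nine : List V
        nine = l₀ ∷ l ∷ m ∷ u ∷ k ∷ w ∷ corners

        module N = Named nine d

        L : List (V × V)
        L = proj₁ (maximalMatching nine)
        val : Valid nine L
        val = proj₁ (proj₂ (maximalMatching nine))
        max : Maximal nine L
        max = proj₂ (proj₂ (maximalMatching nine))

        k∉ : k ∉ corners
        k∉ = N.fresh 4F (6F ∷ 7F ∷ 8F ∷ [])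
        m∉ : m ∉ corners
        m∉ = N.fresh 2F (6F ∷ 7F ∷ 8F ∷ [])
        l∉ : l ∉ corners
        l∉ = N.fresh 1F (6F ∷ 7F ∷ 8F ∷ [])

        three : 3 + length L ≡ h
        three = equimatchable-corners (N.build es is (ll₀ , mu , kw , tt) val) λ e fp fq →
          case N.leftover es is fp , N.leftover es is fq of λ { (inj₂ fp , inj₂ fq) → max e fp fq }
          where
          es = (1F , 0F) ∷ (2F , 3F) ∷ (4F , 5F) ∷ []
          is = 6F ∷ 7F ∷ 8F ∷ []

        module _ {p : V} (fp : Free nine L p) where

          private
            module M = Named (p ∷ nine) (proj₁ fp ∷ d)
            is : List M.I
            is = 7F ∷ 8F ∷ 9F ∷ []
            val′ : Valid (p ∷ nine) L
            val′ = valid-avoid val (proj₂ fp)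

          -- This and the next three exchanges start from kw, mu, `ll₀` with L. Using an edge at p
          -- instead would give a matching of H with h edges that misses k, m or l; for y, the
          -- missed neighbour is p itself. Both contradict `large-covers`.
          w≁free : ¬ w ~ p
          w≁free wp = M.uncovered es 5F val′ (large-covers (M.build es is (mu , wp , ll₀ , tt) val′) three (inj₁ xk , k∉))
            where es = (3F , 4F) ∷ (6F , 0F) ∷ (2F , 1F) ∷ []

          u≁free : ¬ u ~ p
          u≁free up = M.uncovered es 3F val′ (large-covers (M.build es is (kw , up , ll₀ , tt) val′) three (inj₂ (inj₁ ym) , m∉))
            where es = (5F , 6F) ∷ (4F , 0F) ∷ (2F , 1F) ∷ []

          l₀≁free : ¬ l₀ ~ p
          l₀≁free l₀p = M.uncovered es 2F val′ (large-covers (M.build es is (kw , mu , l₀p , tt) val′) three (inj₂ (inj₂ zl) , l∉))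
            where es = (5F , 6F) ∷ (3F , 4F) ∷ (1F , 0F) ∷ []

          y≁free : ¬ y ~ p
          y≁free yp = M.uncovered es 0F val′ (large-covers (M.build es is (kw , mu , ll₀ , tt) val′) three
                        (inj₂ (inj₁ yp) , M.fresh 0F is))
            where es = (5F , 6F) ∷ (3F , 4F) ∷ (2F , 1F) ∷ []

        -- Here km, `ll₀` and L have h - 1 edges in H, so one more edge fits. Of the named vertices
        -- only u and w are uncovered, and neither has a neighbour free for L.
        w~u : w ~ u
        w~u = from (enlarge equimatchable-corners (N.build es is (km , ll₀ , tt) val) (ℕ.≤-reflexive three))
          where
          es = (4F , 2F) ∷ (1F , 0F) ∷ []
          is = 6F ∷ 7F ∷ 8F ∷ []
          from : (∃[ p ] ∃[ q ] p ~ q × Free (N.names is) (N.edges es ++ L) p × Free (N.names is) (N.edges es ++ L) q) → w ~ u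
          from (p , q , e , fp , fq) with N.leftover es is fp | N.leftover es is fq
          ... | inj₂ fp                 | inj₂ fq                 = ⊥-elim (max e fp fq)
          ... | inj₂ fp                 | inj₁ (here refl)         = ⊥-elim (u≁free fp (~-sym e))
          ... | inj₂ fp                 | inj₁ (there (here refl)) = ⊥-elim (w≁free fp (~-sym e))
          ... | inj₁ (here refl)         | inj₂ fq                 = ⊥-elim (u≁free fq e)
          ... | inj₁ (there (here refl)) | inj₂ fq                 = ⊥-elim (w≁free fq e)
          ... | inj₁ (here refl)         | inj₁ (here refl)         = ⊥-elim (~⇒≢ e refl)
          ... | inj₁ (here refl)         | inj₁ (there (here refl)) = ~-sym e
          ... | inj₁ (there (here refl)) | inj₁ (here refl)         = e
          ... | inj₁ (there (here refl)) | inj₁ (there (here refl)) = ⊥-elim (~⇒≢ e refl)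

        -- Here zl, xk, mu and L have h edges, one fewer than a maximal matching of G. The uncovered
        -- named vertices are `l₀`, w and y, and `l₀` is adjacent to neither of the others.
        w~y : w ~ y
        w~y = from (enlarge eqm (N.build es [] (zl , xk , mu , tt) val) (s≤s (ℕ.≤-reflexive three)))
          where
          es = (8F , 1F) ∷ (6F , 4F) ∷ (2F , 3F) ∷ []
          from : (∃[ p ] ∃[ q ] p ~ q × Free [] (N.edges es ++ L) p × Free [] (N.edges es ++ L) q) → w ~ y
          from (p , q , e , fp , fq) with N.leftover es [] fp | N.leftover es [] fq
          ... | inj₂ fp                          | inj₂ fq                          = ⊥-elim (max e fp fq)
          ... | inj₂ fp                          | inj₁ (here refl)                 = ⊥-elim (l₀≁free fp (~-sym e))
          ... | inj₂ fp                          | inj₁ (there (here refl))         = ⊥-elim (w≁free fp (~-sym e))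
          ... | inj₂ fp                          | inj₁ (there (there (here refl))) = ⊥-elim (y≁free fp (~-sym e))
          ... | inj₁ (here refl)                 | inj₂ fq                          = ⊥-elim (l₀≁free fq e)
          ... | inj₁ (there (here refl))         | inj₂ fq                          = ⊥-elim (w≁free fq e)
          ... | inj₁ (there (there (here refl))) | inj₂ fq                          = ⊥-elim (y≁free fq e)
          ... | inj₁ (here refl)                 | inj₁ (here refl)                 = ⊥-elim (~⇒≢ e refl)
          ... | inj₁ (here refl)                 | inj₁ (there (here refl))         = ⊥-elim (l₀≁w e)
          ... | inj₁ (here refl)                 | inj₁ (there (there (here refl))) = ⊥-elim (l₀≁y e)
          ... | inj₁ (there (here refl))         | inj₁ (here refl)                 = ⊥-elim (l₀≁w (~-sym e))
          ... | inj₁ (there (here refl))         | inj₁ (there (here refl))         = ⊥-elim (~⇒≢ e refl)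
          ... | inj₁ (there (here refl))         | inj₁ (there (there (here refl))) = e
          ... | inj₁ (there (there (here refl))) | inj₁ (here refl)                 = ⊥-elim (l₀≁y (~-sym e))
          ... | inj₁ (there (there (here refl))) | inj₁ (there (here refl))         = ~-sym e
          ... | inj₁ (there (there (here refl))) | inj₁ (there (there (here refl))) = ⊥-elim (~⇒≢ e refl)

        es₀ : List (N.I × N.I)
        es₀ = (1F , 0F) ∷ []
        is₀ : List N.I
        is₀ = 6F ∷ 8F ∷ 2F ∷ 4F ∷ 3F ∷ 7F ∷ []

        val₀ : Valid (x ∷ z ∷ m ∷ k ∷ u ∷ y ∷ []) ((l , l₀) ∷ L)
        val₀ = N.build es₀ is₀ (ll₀ , tt) val

        -- The only uncovered named vertex is w, and it has no neighbour free for L.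
        max₀ : Maximal (x ∷ z ∷ m ∷ k ∷ u ∷ y ∷ []) ((l , l₀) ∷ L)
        max₀ e fp fq with N.leftover es₀ is₀ fp | N.leftover es₀ is₀ fq
        ... | inj₂ fp         | inj₂ fq         = max e fp fq
        ... | inj₂ fp         | inj₁ (here refl) = w≁free fp (~-sym e)
        ... | inj₁ (here refl) | inj₂ fq         = w≁free fq e
        ... | inj₁ (here refl) | inj₁ (here refl) = ~⇒≢ e refl

        S : EdgeSet n
        S = insert x z (toSet ((l , l₀) ∷ L))

        S-good : Good (m ∷ k ∷ u ∷ y ∷ []) S
        S-good = insert-good xz (N.fresh 6F (2F ∷ 4F ∷ 3F ∷ 7F ∷ [])) (N.fresh 8F (2F ∷ 4F ∷ 3F ∷ 7F ∷ []))
                   (matching-good val₀ max₀)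

        w-uncovered : ∀ {b} → S w b ≢ true
        w-uncovered p with insert⁻ {S = toSet ((l , l₀) ∷ L)} p
        ... | inj₁ (inj₁ (e , _)) = N.distinct-at 5F 6F e
        ... | inj₁ (inj₂ (e , _)) = N.distinct-at 5F 8F e
        ... | inj₂ q              = N.uncovered es₀ 5F val (touches-cov ((l , l₀) ∷ L) q)

        w-fresh : w ∉ m ∷ k ∷ u ∷ y ∷ []
        w-fresh = N.fresh 5F (2F ∷ 4F ∷ 3F ∷ 7F ∷ [])

        -- The uncovered vertex w is the partner of all three leaves k, u and y.
        starred : ∃[ T ] Good [] T × size T ≡ 3 + size S
        starred = extend-star S-good (λ ()) (λ ()) (λ ()) (λ ())
          (N.distinct-at 4F 3F) (N.distinct-at 4F 7F) (N.distinct-at 3F 7F)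
          (~-sym km) mu (~-sym ym) kw (~-sym w~u) (~-sym w~y)
          w-fresh w-fresh w-fresh w-uncovered w-uncovered w-uncovered

        -- Three star edges, xz, `ll₀` and the h - 3 edges of L make h + 2 instead of h + 1.
        too-large : ⊥
        too-large = let T , T-good , size-T = starred in ℕ.<⇒≢ (ℕ.n<1+n _) (begin
          suc h                            ≡⟨ number T-good ⟨
          size T                           ≡⟨ size-T ⟩
          3 + size S                       ≡⟨ cong (3 +_) (size-insert-good xz (matching-good val₀ max₀)) ⟩
          4 + size (toSet ((l , l₀) ∷ L))  ≡⟨ cong (4 +_) (size-matching val₀ max₀) ⟩
          2 + (3 + length L)               ≡⟨ cong (2 +_) three ⟩
          2 + h                            ∎)
          where open ≡-Reasoning

    -- Otherwise k w u m is a 4-cycle, w is also adjacent to y, and the star at m with leaves k, u, y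
    -- extends to a minimal edge dominating set that leaves w uncovered and is too large.
    no-third-neighbour : ∀ {K k m l w} → Separated corners x y z K →
      x ~ k → y ~ m → z ~ l → k ∉ corners → m ∉ corners → l ∉ corners → k ~ m →
      k ~ w → w ≢ x → w ≢ m → ⊥
    no-third-neighbour {K} {k} {m} {l} {w} (region , Kx , Ky , ¬Kz) xk ym zl k∉ m∉ l∉ km kw w≢x w≢m =
      second (attached-mate val₁ (inj₂ (inj₁ ym) , m∉) m∉₁)
      where
      open Region region
      w∉ : w ∉ corners
      w∉ = w≢x ∉∷ (λ { refl → no-triangle k∉ (~-sym xk) xy kw }) ∉∷ (λ { refl → no-triangle k∉ (~-sym xk) xz kw }) ∉∷ λ ()
      val₁ : Valid corners ((k , w) ∷ [])
      val₁ = add kw k∉ w∉ []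
      m∉₁ : m ∉ k ∷ w ∷ []
      m∉₁ = (λ { refl → ~⇒≢ km refl }) ∉∷ (λ { refl → w≢m refl }) ∉∷ λ ()
      Kw : K w ≡ true
      Kw = closed (Kx xk k∉) kw w∉
      second : (∃[ u ] m ~ u × Free corners ((k , w) ∷ []) u) → ⊥
      second (u , mu , u∉ , u∉₁) = third (attached-mate val₂ (inj₂ (inj₂ zl) , l∉) l∉₂)
        where
        val₂ : Valid corners ((m , u) ∷ (k , w) ∷ [])
        val₂ = add-free mu (m∉ , m∉₁) (u∉ , u∉₁) val₁
        -- Separation supplies the distinctness: k, w, m and u lie in K, while l does not.
        l≢ : ∀ {v} → K v ≡ true → l ≢ v
        l≢ Kv refl = ¬Kz zl l∉ Kv
        l∉₂ : l ∉ m ∷ u ∷ k ∷ w ∷ []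
        l∉₂ = l≢ (Ky ym m∉) ∉∷ l≢ (closed (Ky ym m∉) mu u∉) ∉∷ l≢ (Kx xk k∉) ∉∷ l≢ Kw ∉∷ λ ()
        third : (∃[ l₀ ] l ~ l₀ × Free corners ((m , u) ∷ (k , w) ∷ []) l₀) → ⊥
        third (l₀ , ll₀ , l₀∉ , l₀∉₂) = Nine.too-large
          (((λ { refl → ~⇒≢ ll₀ refl }) ∉∷ ∉-++ l₀∉₂ l₀∉) ∷ ∉-++ l∉₂ l∉ ∷ ∉-++ (~⇒≢ mu ∉∷ m∉₁) m∉ ∷
            ∉-++ u∉₁ u∉ ∷ (~⇒≢ kw ∉∷ k∉) ∷ w∉ ∷ distinct)
          xk ym zl km kw mu ll₀ (λ e → ¬Kl₀ (Ky (~-sym e) l₀∉)) (λ e → ¬Kl₀ (closed Kw (~-sym e) l₀∉))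
          where
          ¬Kl₀ : K l₀ ≢ true
          ¬Kl₀ Kl₀ = ¬Kz zl l∉ (closed Kl₀ (~-sym ll₀) l∉)

    -- Otherwise the edges of G - {x,y,z,m} that avoid l dominate it; a minimal dominating subset S leaves l
    -- uncovered, so both S with the star at y with leaves x, z, m and S with the matching xz, ym are
    -- minimal edge dominating sets.
    uncovered-neighbour : ∀ {k m l} → x ~ k → y ~ m → z ~ l → k ∉ corners → m ∉ corners → l ∉ corners → k ~ m → l ≢ m →
      (∀ {v} → k ~ v → v ≡ x ⊎ v ≡ m) →
      (∀ {p} → l ~ p → p ∉ y ∷ x ∷ z ∷ m ∷ [] → ∃[ q ] p ~ q × q ∉ y ∷ x ∷ z ∷ m ∷ l ∷ []) → ⊥
    uncovered-neighbour {k} {m} {l} xk ym zl k∉ m∉ l∉ km l≢m Nk other =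
      ℕ.<⇒≢ (ℕ.n<1+n _) (trans (trans (sym two) (number matched))
        (trans (sym (number (proj₁ (proj₂ starred)))) (proj₂ (proj₂ starred))))
      where
      C R : List V
      C = y ∷ x ∷ z ∷ m ∷ []
      R = y ∷ x ∷ z ∷ m ∷ l ∷ []
      within? : ∀ i j → Dec (i ~ j × i ∉ R × j ∉ R)
      within? i j = (i ~? j) ×-dec ((i ∉? R) ×-dec (j ∉? R))
      D : EdgeSet n
      D i j = does (within? i j)
      D⁻ : ∀ {i j} → D i j ≡ true → i ~ j × i ∉ R × j ∉ R
      D⁻ {i} {j} = does⁻ (within? i j)
      D⁺ : ∀ {i j} → i ~ j → i ∉ R → j ∉ R → D i j ≡ true
      D⁺ {i} {j} e i∉ j∉ = dec-true (within? i j) (e , i∉ , j∉)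
      C⊆R : C ⊆ R
      C⊆R = ∈-++⁺ˡ
      -- An edge at l is still dominated, by an edge from its other end v to a second neighbour q.
      at-l : ∀ {v} → l ~ v → v ∉ C → Touches D v
      at-l lv v∉ with other lv v∉
      ... | q , vq , q∉ = q , D⁺ vq (∉-++ v∉ (λ { (here refl) → ~⇒≢ lv refl })) q∉
      dom : ∀ {u v} → u ~ v → u ∉ C → v ∉ C → Touches D u ⊎ Touches D v
      dom {u} {v} e u∉ v∉ = case u ≟ l of λ
        { (yes refl) → inj₂ (at-l e v∉)
        ; (no u≢l)   → case v ≟ l of λ
          { (yes refl) → inj₁ (at-l (~-sym e) u∉)
          ; (no v≢l)   → inj₁ (v , D⁺ e (∉-++ u∉ (u≢l ∉∷ λ ())) (∉-++ v∉ (v≢l ∉∷ λ ()))) } }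
      D-dominating : Dominating C D
      D-dominating = record
        { symm  = λ i j → true⇔true (λ p → let e , i∉ , j∉ = D⁻ p in D⁺ (~-sym e) j∉ i∉)
                                    (λ p → let e , i∉ , j∉ = D⁻ p in D⁺ (~-sym e) j∉ i∉)
        ; edge  = λ p → proj₁ (D⁻ p)
        ; avoid = λ p i∈ → proj₁ (proj₂ (D⁻ p)) (C⊆R i∈)
        ; dom   = dom }
      S : EdgeSet n
      S = proj₁ (minimise C D-dominating)
      S-good : Good C S
      S-good = proj₁ (proj₂ (minimise C D-dominating))
      S⊆D : S ⊆ₑ D
      S⊆D = proj₂ (proj₂ (minimise C D-dominating))
      Sl : ∀ {d} → S l d ≢ true
      Sl p = proj₁ (proj₂ (D⁻ (S⊆D _ _ p))) (there (there (there (there (here refl)))))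
      -- Both neighbours of k are deleted, so k is untouched and serves as partner of x and m; l is
      -- the partner of z.
      Sk : ∀ {d} → S k d ≢ true
      Sk p with D⁻ (S⊆D _ _ p)
      ... | kd , _ , d∉ with Nk kd
      ...   | inj₁ refl = d∉ (there (here refl))
      ...   | inj₂ refl = d∉ (there (there (there (here refl))))
      x≢m : x ≢ m
      x≢m refl = m∉ (here refl)
      z≢m : z ≢ m
      z≢m refl = m∉ (there (there (here refl)))
      k∉C : k ∉ C
      k∉C = (k∉ ∘ there ∘ here) ∉∷ (k∉ ∘ here) ∉∷ (k∉ ∘ there ∘ there ∘ here) ∉∷ ~⇒≢ km ∉∷ λ ()
      l∉C : l ∉ C
      l∉C = (l∉ ∘ there ∘ here) ∉∷ (l∉ ∘ here) ∉∷ (l∉ ∘ there ∘ there ∘ here) ∉∷ l≢m ∉∷ λ ()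
      starred : ∃[ T ] Good [] T × size T ≡ 3 + size S
      starred = extend-star S-good (λ ()) (λ ()) (λ ()) (λ ()) (~⇒≢ xz) x≢m z≢m
                  (~-sym xy) yz ym xk zl (~-sym km) k∉C l∉C k∉C Sk Sl Sk
      S-good′ : Good (x ∷ z ∷ y ∷ m ∷ []) S
      S-good′ = permute-good (pull₂ ∘ pull₂) pull₂ S-good
      S-good″ : Good (y ∷ m ∷ []) (insert x z S)
      S-good″ = insert-good xz (~⇒≢ xy ∉∷ x≢m ∉∷ λ ()) (~⇒≢ (~-sym yz) ∉∷ z≢m ∉∷ λ ()) S-good′
      matched : Good [] (insert y m (insert x z S))
      matched = insert-good ym (λ ()) (λ ()) S-good″
      two : size (insert y m (insert x z S)) ≡ 2 + size S
      two = trans (size-insert-good ym S-good″) (cong suc (size-insert-good xz S-good′))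

-- Alternation of vertices missed by maximum matchings.

module Bipartition {n} (G : Graph n) where
  open Domination G
  open Triangles G

  -- k bounds the number of edges.
  data Path (R : List V) : V → V → ℕ → Set where
    here : ∀ {u k} → u ∉ R → Path R u u k
    step : ∀ {u v w k} → u ∉ R → u ~ v → Path R v w k → Path R u w (suc k)

  path-suc : ∀ {R u v k} → Path R u v k → Path R u v (suc k)
  path-suc (here u∉)     = here u∉
  path-suc (step u∉ e p) = step u∉ e (path-suc p)

  path-snoc : ∀ {R u v w k} → Path R u v k → v ~ w → w ∉ R → Path R u w (suc k)
  path-snoc (here u∉) e w∉      = step u∉ e (here w∉)
  path-snoc (step u∉ e p) e′ w∉ = step u∉ e (path-snoc p e′ w∉)

  path-start : ∀ {R u v k} → Path R u v k → u ∉ R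
  path-start (here u∉)     = u∉
  path-start (step u∉ _ _) = u∉

  path-end : ∀ {R u v k} → Path R u v k → v ∉ R
  path-end (here u∉)    = u∉
  path-end (step _ _ p) = path-end p

  last-visit : ∀ {R s u k} w → Path R s u k → u ≢ w →
               Path (w ∷ R) s u k ⊎ (∃[ a ] w ~ a × Path (w ∷ R) a u k)
  last-visit w (here u∉) u≢w = inj₁ (here (u≢w ∉∷ u∉))
  last-visit w (step {s} s∉ e p) u≢w with last-visit w p u≢w
  ... | inj₂ (a , wa , q) = inj₂ (a , wa , path-suc q)
  ... | inj₁ q with s ≟ w
  ...   | yes refl = inj₂ (_ , e , path-suc q)
  ...   | no s≢w   = inj₁ (step (s≢w ∉∷ s∉) e q)

  -- Cutting at the last visit to w removes at least one edge, so the bound drops.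
  depart : ∀ {R w u k} → Path R w u (suc k) → u ≢ w → ∃[ a ] w ~ a × Path (w ∷ R) a u k
  depart (here _) u≢w = ⊥-elim (u≢w refl)
  depart {w = w} (step {v = v} _ e p) u≢w with last-visit w p u≢w
  ... | inj₁ q           = v , e , q
  ... | inj₂ (a , e′ , q) = a , e′ , q

  TriangleFree : List V → Set
  TriangleFree R = ∀ {a b c} → a ∉ R → b ∉ R → c ∉ R → a ~ b → b ~ c → a ~ c → ⊥

  -- With t the matching number of G - R, these are the vertices of the set D in the Gallai-Edmonds
  -- decomposition.
  Missable : List V → ℕ → V → Set
  Missable R t u = ∃[ L ] Valid (u ∷ R) L × length L ≡ t

  module _ {R t w} (tf : TriangleFree R) (eq : Equimatchable R t) (eqw : Equimatchable (w ∷ R) t) (w∉ : w ∉ R) where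

    -- Otherwise wa could be added, giving t + 1 edges in G - R.
    saturated : ∀ {a L} → w ~ a → a ∉ R → Valid (w ∷ R) L → length L ≡ t → a ∈ cov L
    saturated {a} {L} wa a∉ val len with a ∈? cov L
    ... | yes p = p
    ... | no p  = ⊥-elim (ℕ.<⇒≱ (ℕ.n<1+n t) (subst (λ s → suc s ≤ t) len
                    (matching-≤ eq (add wa w∉ a∉ (valid-⊆ pull₁ (valid-avoid val p))))))

    -- With pq added the matching has t edges and still avoids w, so it must cover a.
    extension-covers : ∀ {a L p q} → w ~ a → a ∉ R → a ∉ cov L → Valid (w ∷ R) L → suc (length L) ≡ t →
      p ~ q → Free (w ∷ R) L p → Free (w ∷ R) L q → a ≡ p ⊎ a ≡ q
    extension-covers wa a∉ a∉L val len e fp fq with saturated wa a∉ (add-free e fp fq val) len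
    ... | here eq          = inj₁ eq
    ... | there (here eq)  = inj₂ eq
    ... | there (there i)  = ⊥-elim (a∉L i)

    -- An edge enlarging L in G - R - w would have to cover both vertices, hence join them, and
    -- close a triangle with w.
    no-two-missed : ∀ {a a′ L} → w ~ a → w ~ a′ → a ≢ a′ → a ∉ R → a′ ∉ R → a ∉ cov L → a′ ∉ cov L →
      Valid (w ∷ R) L → suc (length L) ≢ t
    no-two-missed wa wa′ a≢a′ a∉ a′∉ a∉L a′∉L val len
      with enlarge eqw val (ℕ.≤-reflexive len)
    ... | p , q , e , fp , fq with extension-covers wa a∉ a∉L val len e fp fq
                                 | extension-covers wa′ a′∉ a′∉L val len e fp fq
    ...   | inj₁ refl | inj₁ refl = a≢a′ refl
    ...   | inj₂ refl | inj₂ refl = a≢a′ refl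
    ...   | inj₁ refl | inj₂ refl = tf w∉ a∉ a′∉ wa e wa′
    ...   | inj₂ refl | inj₁ refl = tf w∉ a′∉ a∉ wa′ e wa

    missable-base : Missable R t w
    missable-base = let L , val , max = maximalMatching (w ∷ R) in L , val , eqw val max

    -- A matching with t edges that misses a must cover w. Dropping its edge at w leaves t - 1 edges
    -- that miss w, a and the former mate of w.
    neighbour-not-missable : ∀ {a} → w ~ a → a ∉ R → ¬ Missable R t a
    neighbour-not-missable {a} wa a∉ (L , val , len) with w ∈? cov L
    ... | no w∉L = disjoint val (here refl) (saturated wa a∉ (valid-avoid (valid-⊆ there val) w∉L) len)
    ... | yes w∈ = no-two-missed wa v~mate (λ e → mate∉ (here (sym e))) a∉ (mate∉ ∘ there)
                     (disjoint valid (there (there (here refl)))) (disjoint valid (there (here refl)))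
                     (valid-⊆ (cons-⊆ (there ∘ there)) valid) (trans (sym len′) len)
      where open Mate (removeMate val w∈) renaming (len to len′)

    -- L with ap is maximal in G - R - w and so has t edges; trading ap for wa frees p.
    second-missable : ∀ {a p} → w ~ a → a ∉ R → a ~ p → p ∉ w ∷ R → Missable R t p
    second-missable {a} {p} wa a∉ ap p∉ with maximalMatching (p ∷ a ∷ w ∷ R)
    ... | L , val , max = (w , a) ∷ L ,
        add wa ((λ { refl → p∉ (here refl) }) ∉∷ w∉) (~⇒≢ ap ∉∷ a∉)
          (valid-⊆ (λ { (here e)                  → there (there (here e))
                      ; (there (here e))          → there (here e)
                      ; (there (there (here e)))  → here e
                      ; (there (there (there i))) → there (there (there i)) }) val) ,
        eqw (add ap (~⇒≢ (~-sym wa) ∉∷ a∉) p∉ (valid-⊆ pull₁ val))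
            (λ e fp fq → max e (permute (free-shift fp)) (permute (free-shift fq)))
      where
      permute : ∀ {v} → Free (a ∷ p ∷ w ∷ R) L v → Free (p ∷ a ∷ w ∷ R) L v
      permute (v∉ , v∉L) = (v∉ ∘ pull₁) , v∉L

    module _ {a t′} (wa : w ~ a) (a∉ : a ∉ R) (t≡ : t ≡ suc t′) where

      lift-missable : ∀ {u} → u ∉ a ∷ w ∷ R → Missable (a ∷ w ∷ R) t′ u → Missable R t u
      lift-missable u∉ (L , val , len) = (w , a) ∷ L ,
        add wa ((λ { refl → u∉ (there (here refl)) }) ∉∷ w∉) ((λ { refl → u∉ (here refl) }) ∉∷ a∉)
          (valid-⊆ (λ { (here e)                  → there (there (here e))
                      ; (there (here e))          → there (here e)
                      ; (there (there (here e)))  → here e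
                      ; (there (there (there i))) → there (there (there i)) }) val) ,
        trans (cong suc len) (sym t≡)

      other-neighbour-not-missable : ∀ {b} → w ~ b → b ∉ a ∷ w ∷ R → ¬ Missable (a ∷ w ∷ R) t′ b
      other-neighbour-not-missable wb b∉ (L , val , len) =
        no-two-missed wa wb (λ { refl → b∉ (here refl) }) a∉ (λ i → b∉ (there (there i)))
          (disjoint val (there (here refl))) (disjoint val (here refl)) (valid-⊆ (λ i → there (there i)) val)
          (trans (cong suc len) (sym t≡))

      -- The hard case is that L matches a to b and w to `a₂`, since dropping both edges loses one
      -- too many. The remainder with ab has t - 1 edges in G - R - w, and an edge enlarging it must
      -- cover `a₂`. Its other end q repairs the loss unless q = u; then the edge from `a₂` to u has
      -- no missable end in the smaller graph, against `alt`.
      lower-missable : ∀ {u} → u ∉ a ∷ w ∷ R →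
        (∀ {b} → u ~ b → b ∉ a ∷ w ∷ R → ¬ (¬ Missable (a ∷ w ∷ R) t′ u × ¬ Missable (a ∷ w ∷ R) t′ b)) →
        Missable R t u → ¬ ¬ Missable (a ∷ w ∷ R) t′ u
      lower-missable {u} u∉ alt (L , val , len) ¬missable with a ∈? cov L
      ... | no a∉L = neighbour-not-missable wa a∉ (L , valid-avoid (valid-⊆ there val) a∉L , len)
      ... | yes a∈ = go (w ∈? cov M)
        where
        open Mate (removeMate val a∈)
          renaming (mate to b; rest to M; v~mate to ab; valid to valM; len to lenM; mate∉ to b∉) using ()
        go : Dec (w ∈ cov M) → ⊥
        go (no w∉M) = ¬missable (M ,
          valid-⊆ (λ { (here e)                  → there (there (there (here e)))
                     ; (there (here e))          → there (here e)
                     ; (there (there (here e)))  → here e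
                     ; (there (there (there i))) → there (there (there (there i))) }) (valid-avoid valM w∉M) ,
          ℕ.suc-injective (trans (sym lenM) (trans len t≡)))
        go (yes w∈) = finish (enlarge eqw val₁ (ℕ.≤-reflexive len₁))
          where
          open Mate (removeMate valM w∈)
            renaming (mate to a₂; rest to N; v~mate to wa₂; valid to valN; len to lenN; v∉ to w∉M; mate∉ to a₂∉) using ()
          val₁ : Valid (w ∷ R) ((a , b) ∷ N)
          val₁ = add ab (~⇒≢ (~-sym wa) ∉∷ a∉) ((λ e → w∉M (there (here (sym e)))) ∉∷ (b∉ ∘ there))
            (valid-⊆ (λ { (here e)                  → there (there (here e))
                        ; (there (here e))          → there (there (there (here e)))
                        ; (there (there (here e)))  → here e
                        ; (there (there (there i))) → there (there (there (there (there i)))) }) valN)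
          len₁ : suc (suc (length N)) ≡ t
          len₁ = trans (cong suc (sym lenN)) (trans (sym lenM) len)
          a₂≢w : a₂ ≢ w
          a₂≢w = ~⇒≢ (~-sym wa₂)
          a₂∉′ : a₂ ∉ a ∷ w ∷ R
          a₂∉′ = (a₂∉ ∘ here) ∉∷ a₂≢w ∉∷ (λ i → a₂∉ (there (there (there i))))
          a₂∉L : a₂ ∉ a ∷ b ∷ cov N
          a₂∉L = (a₂∉ ∘ here) ∉∷ (a₂∉ ∘ there ∘ here) ∉∷ disjoint valN (there (here refl))
          use : ∀ {q} → a₂ ~ q → Free (w ∷ R) ((a , b) ∷ N) q → ⊥
          use {q} e (q∉ , q∉L) with q ≟ u
          ... | yes refl = alt (~-sym e) a₂∉′ (¬missable , other-neighbour-not-missable wa₂ a₂∉′)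
          ... | no q≢u   = ¬missable ((a₂ , q) ∷ N ,
                  add e ((a₂∉ ∘ there ∘ there ∘ here) ∉∷ a₂∉′) (q≢u ∉∷ (q∉L ∘ here) ∉∷ q∉)
                    (valid-⊆ sub (valid-avoid valN (λ i → q∉L (there (there i))))) ,
                  ℕ.suc-injective (trans len₁ t≡))
            where
            sub : a₂ ∷ q ∷ u ∷ a ∷ w ∷ R ⊆ q ∷ w ∷ a₂ ∷ a ∷ b ∷ u ∷ R
            sub (here e)                                  = there (there (here e))
            sub (there (here e))                          = here e
            sub (there (there (here e)))                  = there (there (there (there (there (here e)))))
            sub (there (there (there (here e))))          = there (there (there (here e)))
            sub (there (there (there (there (here e)))))  = there (here e)
            sub (there (there (there (there (there i))))) = there (there (there (there (there (there i)))))
          finish : (∃[ p ] ∃[ q ] p ~ q × Free (w ∷ R) ((a , b) ∷ N) p × Free (w ∷ R) ((a , b) ∷ N) q) → ⊥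
          finish (p , q , e , fp , fq)
            with extension-covers wa₂ (λ i → a₂∉ (there (there (there i)))) a₂∉L val₁ len₁ e fp fq
          ... | inj₁ refl = use e fq
          ... | inj₂ refl = use (~-sym e) fp

  -- Exactly one end is missable, in negated form because `Missable` is not decided.
  Alternating : List V → ℕ → V → V → Set
  Alternating R t u v = ¬ (Missable R t u × Missable R t v) × ¬ (¬ Missable R t u × ¬ Missable R t v)

  alternate : ∀ {R t u v} → Missable R t u → ¬ Missable R t v → Alternating R t u v
  alternate mu nv = (λ (_ , mv) → nv mv) , (λ (nu , _) → nu mu)

  alternate′ : ∀ {R t u v} → ¬ Missable R t u → Missable R t v → Alternating R t u v
  alternate′ nu mv = (λ (mu , _) → nu mu) , (λ (_ , nv) → nv mv)

  EdgesAlternate : ℕ → Set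
  EdgesAlternate k = ∀ {R t w u v} → TriangleFree R → Equimatchable R t → Equimatchable (w ∷ R) t →
    w ∉ R → Path R w u k → u ~ v → v ∉ R → Alternating R t u v

  -- The claim for (G - R, w) reduces to the claim for (G - R - w - a, p), where w a p is a path.
  edges-alternate-step : ∀ k → EdgesAlternate k → EdgesAlternate (suc k)
  edges-alternate-step k ih {R} {t} {w} {u} {v} tf eq eqw w∉ path uv v∉ with u ≟ w
  ... | yes refl = alternate (missable-base tf eq eqw w∉) (neighbour-not-missable tf eq eqw w∉ uv v∉)
  ... | no u≢w with depart path u≢w
  ...   | a , wa , path′ with u ≟ a | v ≟ w
  ...     | yes refl | yes refl = alternate′ (neighbour-not-missable tf eq eqw w∉ wa (path-end path)) (missable-base tf eq eqw w∉)
  ...     | yes refl | no v≢w   = alternate′ (neighbour-not-missable tf eq eqw w∉ wa (path-end path))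
                                    (second-missable tf eq eqw w∉ wa (path-end path) uv (v≢w ∉∷ v∉))
  ...     | no _     | yes refl = alternate′ (neighbour-not-missable tf eq eqw w∉ (~-sym uv) (path-end path))
                                    (missable-base tf eq eqw w∉)
  edges-alternate-step zero ih tf eq eqw w∉ path uv v∉ | no u≢w | a , wa , here _ | no u≢a | no v≢w = ⊥-elim (u≢a refl)
  edges-alternate-step (suc k) ih {R} {t} {w} {u} {v} tf eq eqw w∉ path uv v∉ | no u≢w | a , wa , path′ | no u≢a | no v≢w
    with depart path′ u≢a | path-start path′ ∘ there | v ≟ a
  ... | p , ap , path″ | a∉ | yes refl = alternate (second-missable tf eq eqw w∉ wa a∉ (~-sym uv) (u≢w ∉∷ path-end path))
                                           (neighbour-not-missable tf eq eqw w∉ wa a∉)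
  ... | p , ap , path″ | a∉ | no v≢a = goal
    where
    p∉ : p ∉ a ∷ w ∷ R
    p∉ = path-start path″
    second : Missable R t p
    second = second-missable tf eq eqw w∉ wa a∉ ap (p∉ ∘ there)
    t′ : ℕ
    t′ = length (proj₁ (maximalMatching (w ∷ a ∷ R)))
    t≡ : t ≡ suc t′
    t≡ = let L , val , max = maximalMatching (w ∷ a ∷ R) in
      sym (eq (add wa w∉ a∉ val) (λ e fp fq → max e (free-shift fp) (free-shift fq)))
    u∉′ : u ∉ a ∷ w ∷ R
    u∉′ = u≢a ∉∷ u≢w ∉∷ path-end path
    v∉′ : v ∉ a ∷ w ∷ R
    v∉′ = v≢a ∉∷ v≢w ∉∷ v∉
    -- Two edges of the path are spent and one is given back, so that the claim also covers the
    -- edges at v. Taking wa from G - R and ap from G - R - w lowers both matching numbers to `t′`.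
    smaller : ∀ {u v} → Path (a ∷ w ∷ R) p u (suc k) → u ~ v → v ∉ a ∷ w ∷ R → Alternating (a ∷ w ∷ R) t′ u v
    smaller = ih
      (λ i j l → tf (i ∘ there ∘ there) (j ∘ there ∘ there) (l ∘ there ∘ there))
      (equimatchable-step (~-sym wa) a∉ w∉ (subst (Equimatchable R) t≡ eq))
      (λ val max → equimatchable-step ap (path-start path′) (p∉ ∘ there) (subst (Equimatchable (w ∷ R)) t≡ eqw)
        (valid-⊆ pull₁ val) (maximal-⊆ pull₁ max))
      p∉
    lower : ∀ {u} → Path (a ∷ w ∷ R) p u (suc k) → u ∉ a ∷ w ∷ R → Missable R t u → ¬ ¬ Missable (a ∷ w ∷ R) t′ u
    lower path u∉ = lower-missable tf eq eqw w∉ wa a∉ t≡ u∉ λ e b∉ → proj₂ (smaller path e b∉)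
    goal : Alternating R t u v
    goal = (λ (mu , mv) → lower (path-suc path″) u∉′ mu λ mu′ → lower (path-snoc path″ uv v∉′) v∉′ mv λ mv′ →
              proj₁ (smaller (path-suc path″) uv v∉′) (mu′ , mv′)) ,
           (λ (nu , nv) → proj₂ (smaller (path-suc path″) uv v∉′)
              ((λ m → nu (lift-missable tf eq eqw w∉ wa a∉ t≡ u∉′ m)) , (λ m → nv (lift-missable tf eq eqw w∉ wa a∉ t≡ v∉′ m))))

  edges-alternate : ∀ k → EdgesAlternate k
  edges-alternate zero tf eq eqw w∉ (here _) uv v∉ =
    alternate (missable-base tf eq eqw w∉) (neighbour-not-missable tf eq eqw w∉ uv v∉)
  edges-alternate (suc k) = edges-alternate-step k (edges-alternate k)

-- Relabelling vertices and transporting edge sets.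

insert-self : ∀ {m n} i j (π : Permutation m n) → Permutation.insert i j π ⟨$⟩ʳ i ≡ j
insert-self i j π with i ≟ i
... | yes _  = refl
... | no i≢i = ⊥-elim (i≢i refl)

-- Places the four house vertices first, as the numbering of the glued graph requires.
enumerate-first : ∀ {j n} (f : Fin j → Fin n) → (∀ {a b} → f a ≡ f b → a ≡ b) →
                  ∃[ m ] Σ (Permutation n (j + m)) λ φ → ∀ i → φ ⟨$⟩ʳ f i ≡ i ↑ˡ m
enumerate-first {zero}  {n} f inj = n , Permutation.id , λ ()
enumerate-first {suc j} {zero}  f inj = case f zero of λ ()
enumerate-first {suc j} {suc n} f inj with enumerate-first (λ i → punchOut (f0≢ i)) inj′
  where
  f0≢ : ∀ i → f zero ≢ f (suc i)
  f0≢ i eq = case inj eq of λ ()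
  inj′ : ∀ {a b} → punchOut (f0≢ a) ≡ punchOut (f0≢ b) → a ≡ b
  inj′ {a} {b} eq = case inj (punchOut-injective (f0≢ a) (f0≢ b) eq) of λ { refl → refl }
... | m , φ , φ-first = m , Permutation.insert (f zero) zero φ , λ
  { zero    → insert-self (f zero) zero φ
  ; (suc i) → trans (cong (Permutation.insert (f zero) zero φ ⟨$⟩ʳ_) (sym (punchIn-punchOut _)))
                (trans (Permutation.insert-punchIn (f zero) zero φ _) (cong suc (φ-first i))) }

module _ {n} (G : Graph n) where
  open Domination G

  -- The image of ψ is the complement of R, and private edges are carried along ψ, so minimality in
  -- the relabelled subgraph becomes minimality in G - R.
  image-good : ∀ {p} (H : Graph p) (ψ : Fin p → Fin n) {R : List V} → (∀ {a b} → ψ a ≡ ψ b → a ≡ b) →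
    (∀ i j → adj H i j ≡ adj G (ψ i) (ψ j)) → (∀ i → ψ i ∉ R) → (∀ v → v ∉ R → ∃[ i ] ψ i ≡ v) →
    ∀ {S} → IsMinimalEDS H S → Good R (image ψ S) × size (image ψ S) ≡ size S
  image-good H ψ {R} inj adj≡ ψ∉ onto {S} min = record
    { dominating = record
      { symm  = image-symmetric ψ S.symm
      ; edge  = λ p → case image⁻ ψ {S} p of λ { (a , b , (refl , refl) , s) → trans (sym (adj≡ a b)) (S.edge s) }
      ; avoid = λ p → case image⁻ ψ {S} p of λ { (a , b , (refl , refl) , s) → ψ∉ a }
      ; dom   = dom }
    ; priv = priv } , size-image ψ inj S S.symm S.irreflexive
    where
    module S = Domination.Good (Domination.minimal⇒good H min)
    push : ∀ {a} → Domination.Touches H S a → Touches (image ψ S) (ψ a)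
    push (d , s) = ψ d , image⁺ ψ {S} s
    dom : ∀ {u v} → u ~ v → u ∉ R → v ∉ R → Touches (image ψ S) u ⊎ Touches (image ψ S) v
    dom e u∉ v∉ with onto _ u∉ | onto _ v∉
    ... | a , refl | b , refl with S.dom (trans (adj≡ a b) e) (λ ()) (λ ())
    ...   | inj₁ t = inj₁ (push t)
    ...   | inj₂ t = inj₂ (push t)
    priv : ∀ {u v} → image ψ S u v ≡ true → Private R (image ψ S) u v
    priv p with image⁻ ψ {S} p
    ... | a , b , (refl , refl) , s with S.priv s
    ...   | x , y , e , _ , _ , h = ψ x , ψ y , trans (sym (adj≡ x y)) e , ψ∉ x , ψ∉ y , λ c d t c∈ →
              case image⁻ ψ {S} t of λ { (c , d , (refl , refl) , t) →
                case h c d t (case c∈ of λ { (inj₁ q) → inj₁ (inj q) ; (inj₂ q) → inj₂ (inj q) }) of λ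
                  { (inj₁ (refl , refl)) → inj₁ (refl , refl) ; (inj₂ (refl , refl)) → inj₂ (refl , refl) } }

  toSet-symmetric : ∀ L → Symmetric (toSet L)
  toSet-symmetric []            = λ _ _ → refl
  toSet-symmetric ((u , v) ∷ L) = insert-symmetric {S = toSet L} (toSet-symmetric L)

  toSet-cov : ∀ L {u} → u ∈ cov L → Touches (toSet L) u
  toSet-cov ((a , b) ∷ L) (here refl)         = b , insert-new {S = toSet L} (inj₁ (refl , refl))
  toSet-cov ((a , b) ∷ L) (there (here refl)) = a , insert-new {S = toSet L} (inj₂ (refl , refl))
  toSet-cov ((a , b) ∷ L) (there (there i))   = let d , p = toSet-cov L i in d , insert-old {S = toSet L} p

  private
    new≢old : ∀ {R L a b u u′ v} → Valid (a ∷ b ∷ R) L → SameEdge u v a b → toSet L u′ v ≢ true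
    new≢old {L = L} val (inj₁ (_ , refl)) s = disjoint val (there (here refl)) (touches-cov L (trans (toSet-symmetric L _ _) s))
    new≢old {L = L} val (inj₂ (_ , refl)) s = disjoint val (here refl) (touches-cov L (trans (toSet-symmetric L _ _) s))

  toSet-injective : ∀ {R L u u′ v} → Valid R L → toSet L u v ≡ true → toSet L u′ v ≡ true → u ≡ u′
  toSet-injective {L = (a , b) ∷ L} (add ab a∉ b∉ val) p q with insert⁻ {S = toSet L} p | insert⁻ {S = toSet L} q
  ... | inj₁ (inj₁ (refl , refl)) | inj₁ (inj₁ (refl , _))    = refl
  ... | inj₁ (inj₁ (refl , refl)) | inj₁ (inj₂ (_ , refl))    = ⊥-elim (~⇒≢ ab refl)
  ... | inj₁ (inj₂ (refl , refl)) | inj₁ (inj₁ (_ , refl))    = ⊥-elim (~⇒≢ ab refl)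
  ... | inj₁ (inj₂ (refl , refl)) | inj₁ (inj₂ (refl , _))    = refl
  ... | inj₂ s                    | inj₂ s′                   = toSet-injective val s s′
  ... | inj₁ e                    | inj₂ s                    = ⊥-elim (new≢old val e s)
  ... | inj₂ s                    | inj₁ e                    = ⊥-elim (new≢old val e s)

-- From a house attached at z to the family.

module Membership {n} (G : Graph n) where
  open Domination G
  open Triangles G
  open Separation G
  open Tight G
  open Bipartition G

  module _ (conn : Connected G) {h : ℕ} (eqm : Equimatchable [] (suc h)) (number : ∀ {S} → Good [] S → size S ≡ suc h)
    {x y z k m l : V} (T : Triangle x y z)
    (xk : x ~ k) (ym : y ~ m) (zl : z ~ l) (km : k ~ m)
    (k∉ : k ∉ x ∷ y ∷ z ∷ []) (m∉ : m ∉ x ∷ y ∷ z ∷ [])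
    (Nx : ∀ {v} → x ~ v → v ≡ y ⊎ v ≡ z ⊎ v ≡ k) (Ny : ∀ {v} → y ~ v → v ≡ x ⊎ v ≡ z ⊎ v ≡ m)
    (Nk : ∀ {v} → k ~ v → v ≡ x ⊎ v ≡ m) (Nm : ∀ {v} → m ~ v → v ≡ y ⊎ v ≡ k)
    where
    open Triangle T

    -- In this order m, k, x, y are the house vertices p1, p2, p3, p4; z is p5.
    house : List V
    house = m ∷ k ∷ x ∷ y ∷ []

    house-distinct : Distinct house
    house-distinct = (~⇒≢ (~-sym km) ∉∷ (m∉ ∘ here) ∉∷ (m∉ ∘ there ∘ here) ∉∷ λ ()) ∷
      ((k∉ ∘ here) ∉∷ (k∉ ∘ there ∘ here) ∉∷ λ ()) ∷ (~⇒≢ xy ∉∷ λ ()) ∷ (λ ()) ∷ []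

    z∉ : z ∉ house
    z∉ = (λ { refl → m∉ (there (there (here refl))) }) ∉∷ (λ { refl → k∉ (there (there (here refl))) }) ∉∷
         ~⇒≢ (~-sym xz) ∉∷ ~⇒≢ (~-sym yz) ∉∷ λ ()

    house-closed : ∀ {u v} → u ~ v → u ∈ house → v ≢ z → v ∈ house
    house-closed e (here refl) v≢z with Nm e
    ... | inj₁ refl = there (there (there (here refl)))
    ... | inj₂ refl = there (here refl)
    house-closed e (there (here refl)) v≢z with Nk e
    ... | inj₁ refl = there (there (here refl))
    ... | inj₂ refl = here refl
    house-closed e (there (there (here refl))) v≢z with Nx e
    ... | inj₁ refl        = there (there (there (here refl)))
    ... | inj₂ (inj₁ refl) = ⊥-elim (v≢z refl)
    ... | inj₂ (inj₂ refl) = there (here refl)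
    house-closed e (there (there (there (here refl)))) v≢z with Ny e
    ... | inj₁ refl        = there (there (here refl))
    ... | inj₂ (inj₁ refl) = ⊥-elim (v≢z refl)
    ... | inj₂ (inj₂ refl) = here refl

    -- The house can be left only through z, so after its last visit to z a path ending outside the
    -- house never enters it.
    path-from : ∀ u → u ∉ house → ∃[ j ] Path house z u j
    path-from u u∉ with u ≟ z
    ... | yes refl = 0 , here u∉
    ... | no u≢z with walk⇒path (conn z u)
      where
      walk⇒path : ∀ {s t} → Walk G (λ _ → ⊤) s t → ∃[ j ] Path [] s t j
      walk⇒path (Walk.here _)     = 0 , here (λ ())
      walk⇒path (Walk.step _ e w) = let j , p = walk⇒path w in suc j , step (λ ()) e p
    ...   | j , p with depart (path-suc p) u≢z
    ...     | a , za , q = suc j , step z∉ za (outside q)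
      where
      outside : ∀ {a j} → Path (z ∷ []) a u j → Path house a u j
      outside (here _)      = here u∉
      outside (step a∉ e p) = let p′ = outside p in
        step (λ a∈ → path-start p′ (house-closed e a∈ (path-start p ∘ here))) e p′

    t : ℕ
    t = length (proj₁ (maximalMatching (k ∷ m ∷ x ∷ y ∷ [])))

    h≡ : suc h ≡ 2 + t
    h≡ = let L , val , max = maximalMatching (k ∷ m ∷ x ∷ y ∷ []) in
      sym (eqm (add xy (λ ()) (λ ()) (add km ((k∉ ∘ here) ∉∷ (k∉ ∘ there ∘ here) ∉∷ λ ())
                                             ((m∉ ∘ here) ∉∷ (m∉ ∘ there ∘ here) ∉∷ λ ()) val))
               (λ e fp fq → max e (free-shift (free-shift fp)) (free-shift (free-shift fq))))

    rest-equimatchable : Equimatchable house t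
    rest-equimatchable val max = equimatchable-step km
      ((k∉ ∘ here) ∉∷ (k∉ ∘ there ∘ here) ∉∷ λ ()) ((m∉ ∘ here) ∉∷ (m∉ ∘ there ∘ here) ∉∷ λ ())
      (equimatchable-step xy (λ ()) (λ ()) (subst (Equimatchable []) h≡ eqm))
      (valid-⊆ pull₁ val) (maximal-⊆ pull₁ max)

    module Z = Named (z ∷ house) (z∉ ∷ house-distinct)

    -- Without z the completion uses xz and ym, which cover both neighbours of k; with z it uses xy
    -- and km. Two edges are added either way, so both graphs have the number t from which the
    -- alternation starts.
    rest-minus-z-equimatchable : Equimatchable (z ∷ house) t
    rest-minus-z-equimatchable {L} val max = ℕ.suc-injective (ℕ.suc-injective (trans
      (eqm (Z.build es [] (xz , ~-sym ym , tt) val) maximal) h≡))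
      where
      es = (3F , 0F) ∷ (1F , 4F) ∷ []
      isolated : ∀ {q} → k ~ q → ¬ Free [] (Z.edges es ++ L) q
      isolated e (_ , q∉) with Nk e
      ... | inj₁ refl = q∉ (here refl)
      ... | inj₂ refl = q∉ (there (there (here refl)))
      maximal : Maximal [] (Z.edges es ++ L)
      maximal e fp fq with Z.leftover es [] fp | Z.leftover es [] fq
      ... | inj₁ (here refl) | _                = isolated e fq
      ... | inj₂ _           | inj₁ (here refl) = isolated (~-sym e) fp
      ... | inj₂ fp          | inj₂ fq          = max e fp fq

    rest-triangleFree : TriangleFree house
    rest-triangleFree a∉ b∉ c∉ ab bc ac = let a∈ , b∈ , _ = only _ _ _ ab bc ac in
      case trans (apex a∉ a∈) (sym (apex b∉ b∈)) of λ { refl → ~⇒≢ ab refl }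
      where
      apex : ∀ {a} → a ∉ house → OneOf3 x y z a → a ≡ z
      apex a∉ (inj₁ refl)        = ⊥-elim (a∉ (there (there (here refl))))
      apex a∉ (inj₂ (inj₁ refl)) = ⊥-elim (a∉ (there (there (there (here refl)))))
      apex a∉ (inj₂ (inj₂ eq))   = eq

    alternating : ∀ {u v} → u ∉ house → v ∉ house → u ~ v → Alternating house t u v
    alternating u∉ v∉ uv = let j , p = path-from _ u∉ in
      edges-alternate j rest-triangleFree rest-equimatchable rest-minus-z-equimatchable z∉ p uv v∉

    module Rest {b} (φ : Permutation n (4 + b)) (φ-house : ∀ i → φ ⟨$⟩ʳ lookup house i ≡ i ↑ˡ b) where

      ψ : Fin b → V
      ψ i = φ ⟨$⟩ˡ (4 ↑ʳ i)

      code : V → Fin 4 ⊎ Fin b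
      code v = splitAt 4 (φ ⟨$⟩ʳ v)

      decode : Fin 4 ⊎ Fin b → V
      decode (inj₁ i) = lookup house i
      decode (inj₂ i) = ψ i

      code-house : ∀ i → code (lookup house i) ≡ inj₁ i
      code-house i = trans (cong (splitAt 4) (φ-house i)) (splitAt-↑ˡ 4 i b)

      code-ψ : ∀ i → code (ψ i) ≡ inj₂ i
      code-ψ i = trans (cong (splitAt 4) (inverseʳ φ)) (splitAt-↑ʳ 4 b i)

      decode-code : ∀ v → decode (code v) ≡ v
      decode-code v with code v in eq
      ... | inj₁ i = trans (sym (inverseˡ φ)) (trans (cong (φ ⟨$⟩ˡ_) (trans (φ-house i) (splitAt⁻¹-↑ˡ eq))) (inverseˡ φ))
      ... | inj₂ i = trans (cong (φ ⟨$⟩ˡ_) (splitAt⁻¹-↑ʳ {4} eq)) (inverseˡ φ)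

      ψ-injective : ∀ {i j} → ψ i ≡ ψ j → i ≡ j
      ψ-injective {i} {j} eq = case trans (sym (code-ψ i)) (trans (cong code eq) (code-ψ j)) of λ { refl → refl }

      ψ∉ : ∀ i → ψ i ∉ house
      ψ∉ i p with index p | lookup-index p
      ... | j | eq = case trans (sym (code-ψ i)) (trans (cong code eq) (code-house j)) of λ ()

      ψ-onto : ∀ v → v ∉ house → ∃[ i ] ψ i ≡ v
      ψ-onto v v∉ with code v | decode-code v
      ... | inj₁ i | refl = ⊥-elim (v∉ (∈-lookup i))
      ... | inj₂ i | eq   = i , eq

      G′ : Graph b
      G′ = record { adj = λ i j → adj G (ψ i) (ψ j) ; sym = λ i j → Graph.sym G (ψ i) (ψ j) ; irrefl = λ i → irrefl G (ψ i) }

      module _ (w : Fin b) (ψw : ψ w ≡ z) where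

        private
          false′ : ∀ {u v} → ¬ u ~ v → adj G u v ≡ false
          false′ = Bool.¬-not

          m≁x : ¬ m ~ x
          m≁x e with Nm e
          ... | inj₁ eq = ~⇒≢ xy eq
          ... | inj₂ eq = k∉ (here (sym eq))

          k≁y : ¬ k ~ y
          k≁y e with Nk e
          ... | inj₁ eq = ~⇒≢ xy (sym eq)
          ... | inj₂ eq = m∉ (there (here (sym eq)))

          adjacent-to : ∀ {u} → (∀ {v} → v ∉ house → u ~ v → v ≡ z) → u ~ z → ∀ i → adj G u (ψ i) ≡ does (i ≟ w)
          adjacent-to {u} N uz i with i ≟ w
          ... | yes refl = subst (u ~_) (sym ψw) uz
          ... | no i≢w   = false′ λ e → i≢w (ψ-injective (trans (N (ψ∉ i) e) (sym ψw)))

          outward : ∀ a i → adj G (lookup house a) (ψ i) ≡ isP3orP4 a ∧ does (i ≟ w)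
          outward 0F i = false′ λ e → case Nm e of λ
            { (inj₁ eq) → ψ∉ i (there (there (there (here eq)))) ; (inj₂ eq) → ψ∉ i (there (here eq)) }
          outward 1F i = false′ λ e → case Nk e of λ
            { (inj₁ eq) → ψ∉ i (there (there (here eq))) ; (inj₂ eq) → ψ∉ i (here eq) }
          outward 2F i = adjacent-to (λ v∉ e → case Nx e of λ
            { (inj₁ eq) → ⊥-elim (v∉ (there (there (there (here eq))))) ; (inj₂ (inj₁ eq)) → eq
            ; (inj₂ (inj₂ eq)) → ⊥-elim (v∉ (there (here eq))) }) xz i
          outward 3F i = adjacent-to (λ v∉ e → case Ny e of λ
            { (inj₁ eq) → ⊥-elim (v∉ (there (there (here eq)))) ; (inj₂ (inj₁ eq)) → eq
            ; (inj₂ (inj₂ eq)) → ⊥-elim (v∉ (here eq)) }) yz i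

        glued : ∀ s t → adj G (decode s) (decode t) ≡ glueAdj' G′ w s t
        glued (inj₁ 0F) (inj₁ 0F) = irrefl G m
        glued (inj₁ 0F) (inj₁ 1F) = ~-sym km
        glued (inj₁ 0F) (inj₁ 2F) = false′ m≁x
        glued (inj₁ 0F) (inj₁ 3F) = ~-sym ym
        glued (inj₁ 1F) (inj₁ 0F) = km
        glued (inj₁ 1F) (inj₁ 1F) = irrefl G k
        glued (inj₁ 1F) (inj₁ 2F) = ~-sym xk
        glued (inj₁ 1F) (inj₁ 3F) = false′ k≁y
        glued (inj₁ 2F) (inj₁ 0F) = false′ (m≁x ∘ ~-sym)
        glued (inj₁ 2F) (inj₁ 1F) = xk
        glued (inj₁ 2F) (inj₁ 2F) = irrefl G x
        glued (inj₁ 2F) (inj₁ 3F) = xy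
        glued (inj₁ 3F) (inj₁ 0F) = ym
        glued (inj₁ 3F) (inj₁ 1F) = false′ (k≁y ∘ ~-sym)
        glued (inj₁ 3F) (inj₁ 2F) = ~-sym xy
        glued (inj₁ 3F) (inj₁ 3F) = irrefl G y
        glued (inj₁ a) (inj₂ i)   = outward a i
        glued (inj₂ i) (inj₁ a)   = trans (Graph.sym G _ _) (outward a i)
        glued (inj₂ i) (inj₂ j)   = refl

        isomorphic : IsomorphicTo G (glueAdj G′ w)
        isomorphic = φ , λ u v → trans (sym (cong₂ (adj G) (decode-code u) (decode-code v)))
                                   (glued (code u) (code v))

        Coloured : (Fin b → Bool) → Set
        Coloured c = IsBipartition G′ c × count (λ i → notb (c i)) < count c × c w ≡ true

        coloured? : ∀ c → Dec (Coloured c)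
        coloured? c = (all? λ i → all? λ j → (adj G′ i j Bool.≟ true) →-dec ¬? (c i Bool.≟ c j))
          ×-dec ((_ ℕ.<? _) ×-dec (c w Bool.≟ true))

        module _ (c : Fin b → Bool) (c⇔ : ∀ i → (c i ≡ true → Missable house t (ψ i)) × (Missable house t (ψ i) → c i ≡ true)) where

          private
            L : List (V × V)
            L = proj₁ (maximalMatching (z ∷ house))
            val : Valid (z ∷ house) L
            val = proj₁ (proj₂ (maximalMatching (z ∷ house)))
            L-good : Good (z ∷ house) (toSet L)
            L-good = matching-good val (proj₂ (proj₂ (maximalMatching (z ∷ house))))
            len : length L ≡ t
            len = rest-minus-z-equimatchable val (proj₂ (proj₂ (maximalMatching (z ∷ house))))

            bipartite : IsBipartition G′ c
            bipartite i j e eq with c i in ci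
            ... | true  = proj₁ (alternating (ψ∉ i) (ψ∉ j) e) (proj₁ (c⇔ i) ci , proj₁ (c⇔ j) (sym eq))
            ... | false = proj₂ (alternating (ψ∉ i) (ψ∉ j) e)
                            ((λ μ → case trans (sym ci) (proj₂ (c⇔ i) μ) of λ ()) , (λ μ → case trans eq (proj₂ (c⇔ j) μ) of λ ()))

            cw : c w ≡ true
            cw = proj₂ (c⇔ w) (L , subst (λ v → Valid (v ∷ house) L) (sym ψw) val , len)

            notb-true : ∀ {e} → notb e ≡ true → e ≢ true
            notb-true {false} _ ()

            -- L is a maximum matching of the rest, so a vertex it misses is missable. The mate of a
            -- nonmissable vertex lies on the other side and is not w, since L avoids z; sparing w
            -- makes the inequality between the sides strict.
            mate-coloured : ∀ i → notb (c i) ≡ true → ∃[ j ] (c ∖ w) j ≡ true × toSet L (ψ i) (ψ j) ≡ true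
            mate-coloured i ¬ci with ψ i ∈? cov L
            ... | no ψi∉ = ⊥-elim (notb-true ¬ci (proj₂ (c⇔ i) (L , valid-avoid (valid-⊆ there val) ψi∉ , len)))
            ... | yes ψi∈ with toSet-cov G L ψi∈
            ...   | v , p with ψ-onto v (Good.avoid L-good (Good.flip L-good p) ∘ there)
            ...     | j , refl = j , trans (∖-other c w j≢w) cj , p
              where
              j≢w : j ≢ w
              j≢w refl = Good.avoid L-good (Good.flip L-good p) (here ψw)
              cj : c j ≡ true
              cj with c j in eq
              ... | true  = refl
              ... | false = ⊥-elim (bipartite i j (Good.edge L-good p) (trans (Bool.¬-not (notb-true ¬ci)) (sym eq)))

          missable-coloured : Coloured c
          missable-coloured = bipartite ,
            subst (count (λ i → notb (c i)) <_) (sym (count-∖ c w cw))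
              (s≤s (count-injection _ (c ∖ w) (λ i j → toSet L (ψ i) (ψ j) ≡ true) mate-coloured
                (λ p q → ψ-injective (toSet-injective G val p q)))) , cw

        -- Being a suitable colouring is decidable and there are finitely many subsets, so existence
        -- under double negation is enough.
        colouring : ∃[ s ] Coloured (Vec.lookup {n = b} s)
        colouring = decidable-stable (anySubset? (coloured? ∘ Vec.lookup)) λ none →
          ¬¬-comprehension (Missable house t ∘ ψ) λ (c , c⇔) → none (Vec.tabulate c ,
            missable-coloured (Vec.lookup (Vec.tabulate c)) λ i →
              subst (λ e → (e ≡ true → Missable house t (ψ i)) × (Missable house t (ψ i) → e ≡ true))
                (sym (lookup∘tabulate c i)) (c⇔ i))

        -- Adding km and xy turns any minimal edge dominating set of the rest into one of G.
        rest-wed : WellEdgeDominated G′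
        rest-wed S S′ minS minS′ = ℕ.suc-injective (ℕ.suc-injective (trans (sym (total minS)) (total minS′)))
          where
          total : ∀ {S} → IsMinimalEDS G′ S → suc h ≡ 2 + size S
          total {S} min = let g , eq = image-good G G′ ψ ψ-injective (λ _ _ → refl) ψ∉ ψ-onto min
                              g₁ = permute-good pull₁ pull₁ g
                              g₂ = insert-good km ((k∉ ∘ here) ∉∷ (k∉ ∘ there ∘ here) ∉∷ λ ())
                                                  ((m∉ ∘ here) ∉∷ (m∉ ∘ there ∘ here) ∉∷ λ ()) g₁
            in trans (sym (number (insert-good xy (λ ()) (λ ()) g₂)))
                 (trans (size-insert-good xy g₂) (cong suc (trans (size-insert-good km g₁) (cong suc eq))))

    conclude : ∀ {b} (φ : Permutation n (4 + b)) → (∀ i → φ ⟨$⟩ʳ lookup house i ≡ i ↑ˡ b) → InFamilyF G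
    conclude {zero} φ φ-house with Rest.ψ-onto φ φ-house z z∉
    ... | () , _
    conclude {suc b} φ φ-house with Rest.ψ-onto φ φ-house z z∉
    ... | w , ψw = let s , bip , lt , cw = colouring w ψw in
      b , G′ , Vec.lookup s , w , bip , lt , rest-wed w ψw , cw , (deleted-wed , supports) , isomorphic w ψw
      where
      open Rest φ φ-house
      ψ′ : Fin b → V
      ψ′ i = ψ (punchIn w i)
      ψ′∉ : ∀ i → ψ′ i ∉ z ∷ house
      ψ′∉ i = (λ eq → punchInᵢ≢i w i (ψ-injective (trans eq (sym ψw)))) ∉∷ ψ∉ (punchIn w i)
      ψ′-onto : ∀ v → v ∉ z ∷ house → ∃[ i ] ψ′ i ≡ v
      ψ′-onto v v∉ with ψ-onto v (v∉ ∘ there)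
      ... | j , refl = punchOut w≢j , cong ψ (punchIn-punchOut w≢j)
        where
        w≢j : w ≢ j
        w≢j refl = v∉ (here ψw)
      -- Here xz and ym are added instead; k may return to the graph first, since both its
      -- neighbours are still deleted.
      deleted-wed : WellEdgeDominated (deleteVertex G′ w)
      deleted-wed S S′ minS minS′ = ℕ.suc-injective (ℕ.suc-injective (trans (sym (total minS)) (total minS′)))
        where
        C : List V
        C = x ∷ z ∷ m ∷ y ∷ []
        C⊆ : C ⊆ z ∷ house
        C⊆ = λ { (here e) → there (there (there (here e))) ; (there (here e)) → here e
               ; (there (there (here e))) → there (here e)
               ; (there (there (there (here e)))) → there (there (there (there (here e)))) }
        isolated : ∀ {v} → k ~ v → v ∈ C
        isolated e with Nk e
        ... | inj₁ refl = here refl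
        ... | inj₂ refl = there (there (here refl))
        drop : ∀ {u v} → u ~ v → u ∉ C → v ∉ C → u ∉ z ∷ house
        drop e u∉ v∉ (here eq)                                 = u∉ (there (here eq))
        drop e u∉ v∉ (there (here eq))                         = u∉ (there (there (here eq)))
        drop e u∉ v∉ (there (there (here refl)))               = v∉ (isolated e)
        drop e u∉ v∉ (there (there (there (here eq))))         = u∉ (here eq)
        drop e u∉ v∉ (there (there (there (there (here eq))))) = u∉ (there (there (there (here eq))))
        total : ∀ {S} → IsMinimalEDS (deleteVertex G′ w) S → suc h ≡ 2 + size S
        total {S} min = let g , eq = image-good G (deleteVertex G′ w) ψ′ (punchIn-injective w _ _ ∘ ψ-injective)
                                       (λ _ _ → refl) ψ′∉ ψ′-onto min
                            g₁ = rebase C⊆ drop g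
                            g₂ = insert-good xz ((m∉ ∘ here ∘ sym) ∉∷ ~⇒≢ xy ∉∷ λ ())
                                                ((m∉ ∘ there ∘ there ∘ here ∘ sym) ∉∷ ~⇒≢ (~-sym yz) ∉∷ λ ()) g₁
          in trans (sym (number (insert-good (~-sym ym) (λ ()) (λ ()) g₂)))
               (trans (size-insert-good (~-sym ym) g₂) (cong suc (trans (size-insert-good xz g₁) (cong suc eq))))
      -- Without a neighbour of degree one, every neighbour has a second neighbour in the rest
      -- without z, as `uncovered-neighbour` demands.
      supports : ∀ i → adj G′ w (punchIn w i) ≡ true → IsSupportVertex (deleteVertex G′ w) i
      supports i e = decidable-stable
        (any? λ u → (adj (deleteVertex G′ w) i u Bool.≟ true) ×-dec (deg (deleteVertex G′ w) u ℕ.≟ 1)) λ none →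
          uncovered-neighbour eqm number T xk ym (~-cong ψw refl e) k∉ m∉ l∉ km (ψ′∉ i ∘ there ∘ here) Nk (other none)
        where
        l∉ : ψ′ i ∉ corners
        l∉ (here eq)                 = ψ′∉ i (there (there (there (here eq))))
        l∉ (there (here eq))         = ψ′∉ i (there (there (there (there (here eq)))))
        l∉ (there (there (here eq))) = ψ′∉ i (here eq)
        other : ¬ IsSupportVertex (deleteVertex G′ w) i → ∀ {p} → ψ′ i ~ p → p ∉ y ∷ x ∷ z ∷ m ∷ [] →
                ∃[ q ] p ~ q × q ∉ y ∷ x ∷ z ∷ m ∷ ψ′ i ∷ []
        other none {p} lp p∉ with ψ′-onto p
            ((p∉ ∘ there ∘ there ∘ here) ∉∷ (p∉ ∘ there ∘ there ∘ there ∘ here) ∉∷ p≢k ∉∷ (p∉ ∘ there ∘ here) ∉∷ (p∉ ∘ here) ∉∷ λ ())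
          where
          p≢k : p ≢ k
          p≢k refl with Nk (~-sym lp)
          ... | inj₁ eq = ψ′∉ i (there (there (there (here eq))))
          ... | inj₂ eq = ψ′∉ i (there (here eq))
        ... | u , refl with count-avoid (i ∷ []) (adj (deleteVertex G′ w) u)
                (ℕ.≤∧≢⇒< (subst (1 ≤_) (sym (count-∖ (adj (deleteVertex G′ w) u) i (~-sym lp))) (s≤s z≤n))
                  (λ deg≡1 → none (u , lp , sym deg≡1)))
        ...   | j , uj , j∉ = ψ′ j , uj , q∉
          where
          q∉ : ψ′ j ∉ y ∷ x ∷ z ∷ m ∷ ψ′ i ∷ []
          q∉ (here eq)                                 = ψ′∉ j (there (there (there (there (here eq)))))
          q∉ (there (here eq))                         = ψ′∉ j (there (there (there (here eq))))
          q∉ (there (there (here eq)))                 = ψ′∉ j (here eq)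
          q∉ (there (there (there (here eq))))         = ψ′∉ j (there (here eq))
          q∉ (there (there (there (there (here eq))))) = j∉ (here (punchIn-injective w _ _ (ψ-injective eq)))

    in-family : InFamilyF G
    in-family = let b , φ , φ-house = enumerate-first (lookup house) (lookup-injective house-distinct) in conclude φ φ-house

-- Choosing the corner and assembling the result.

module Assembly {n} (G : Graph n) where
  open Domination G
  open Triangles G
  open Separation G
  open Tight G
  open Membership G

  separated-⊆ : ∀ {C C′ p q s K} → C ⊆ C′ → C′ ⊆ C → Separated C p q s K → Separated C′ p q s K
  separated-⊆ s s′ (r , p , q , ns) = record
    { inside = λ Ku → Region.inside r Ku ∘ s′ ; closed = λ Ku e v∉ → Region.closed r Ku e (v∉ ∘ s) } ,
    (λ e u∉ → p e (u∉ ∘ s)) , (λ e u∉ → q e (u∉ ∘ s)) , λ e u∉ → ns e (u∉ ∘ s)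

  separated-swap : ∀ {C p q s K} → Separated C p q s K → Separated C q p s K
  separated-swap (r , p , q , ns) = r , q , p , ns

  separated-apart : ∀ {C p q s K u v} → Separated C p q s K → p ~ u ⊎ q ~ u → s ~ v → u ∉ C → v ∉ C → ¬ u ~ v
  separated-apart (r , p , q , ns) (inj₁ pu) sv u∉ v∉ uv = ns sv v∉ (Region.closed r (p pu u∉) uv v∉)
  separated-apart (r , p , q , ns) (inj₂ qu) sv u∉ v∉ uv = ns sv v∉ (Region.closed r (q qu u∉) uv v∉)

  separated-adjacent : ∀ {C p q s K k m l} → Triple {C} p q s → Separated C p q s K →
    p ~ k → q ~ m → s ~ l → k ∉ C → m ∉ C → l ∉ C → k ~ m
  separated-adjacent {k = k} {m} triple sep pk qm sl k∉ m∉ l∉ = decidable-stable (k ~? m) λ ¬km →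
    triple pk qm sl k∉ m∉ l∉ ¬km (separated-apart sep (inj₁ pk) sl k∉ l∉) (separated-apart sep (inj₂ qm) sl m∉ l∉)

  House : List V → V → V → Set
  House C p q = ∃[ k ] ∃[ m ] p ~ k × q ~ m × k ~ m × k ∉ C × m ∉ C

  house? : ∀ C p q → Dec (House C p q)
  house? C p q = any? λ k → any? λ m →
    (p ~? k) ×-dec ((q ~? m) ×-dec ((k ~? m) ×-dec ((k ∉? C) ×-dec (m ∉? C))))

  module _ (conn : Connected G) {h : ℕ} (eqm : Equimatchable [] (suc h)) (number : ∀ {S} → Good [] S → size S ≡ suc h) where

    -- Separation is used only to refute additional neighbours, so double negation suffices. A
    -- further neighbour of x would be adjacent to m, whose neighbours y and k are already known;
    -- likewise for y and k.
    house⇒family : ∀ {x y z l} → Triangle x y z → House (x ∷ y ∷ z ∷ []) x y → z ~ l → l ∉ x ∷ y ∷ z ∷ [] →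
      ¬ ¬ (∃[ K ] Separated (x ∷ y ∷ z ∷ []) x y z K) → InFamilyF G
    house⇒family {x} {y} {z} {l} T (k , m , xk , ym , km , k∉ , m∉) zl l∉ ¬¬sep =
      in-family conn eqm number T xk ym zl km k∉ m∉ Nx Ny Nk Nm
      where
      open Triangle T
      Nk : ∀ {v} → k ~ v → v ≡ x ⊎ v ≡ m
      Nk {v} kv with v ≟ x | v ≟ m
      ... | yes eq | _      = inj₁ eq
      ... | _      | yes eq = inj₂ eq
      ... | no v≢x | no v≢m = ⊥-elim (¬¬sep λ (K , sep) →
              no-third-neighbour eqm number T sep xk ym zl k∉ m∉ l∉ km kv v≢x v≢m)
      Nm : ∀ {v} → m ~ v → v ≡ y ⊎ v ≡ k
      Nm {v} mv with v ≟ y | v ≟ k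
      ... | yes eq | _      = inj₁ eq
      ... | _      | yes eq = inj₂ eq
      ... | no v≢y | no v≢k = ⊥-elim (¬¬sep λ (K , sep) →
              no-third-neighbour eqm number (swap-triangle T) (separated-swap (separated-⊆ swap₃ swap₃ sep))
                ym xk zl (m∉ ∘ swap₃) (k∉ ∘ swap₃) (l∉ ∘ swap₃) (~-sym km) mv v≢y v≢k)
      triple : Triple x y z
      triple = Corner.some-adjacent eqm T
      Nx : ∀ {v} → x ~ v → v ≡ y ⊎ v ≡ z ⊎ v ≡ k
      Nx {v} xv with v ≟ y | v ≟ z | v ≟ k
      ... | yes eq | _      | _      = inj₁ eq
      ... | _      | yes eq | _      = inj₂ (inj₁ eq)
      ... | _      | _      | yes eq = inj₂ (inj₂ eq)
      ... | no v≢y | no v≢z | no v≢k = ⊥-elim (¬¬sep λ (K , sep) →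
              case Nm (~-sym (separated-adjacent triple sep xv ym zl (~⇒≢ (~-sym xv) ∉∷ v≢y ∉∷ v≢z ∉∷ λ ()) m∉ l∉)) of λ
                { (inj₁ eq) → v≢y eq ; (inj₂ eq) → v≢k eq })
      Ny : ∀ {v} → y ~ v → v ≡ x ⊎ v ≡ z ⊎ v ≡ m
      Ny {v} yv with v ≟ x | v ≟ z | v ≟ m
      ... | yes eq | _      | _      = inj₁ eq
      ... | _      | yes eq | _      = inj₂ (inj₁ eq)
      ... | _      | _      | yes eq = inj₂ (inj₂ eq)
      ... | no v≢x | no v≢z | no v≢m = ⊥-elim (¬¬sep λ (K , sep) →
              case Nk (separated-adjacent triple sep xk yv zl k∉ (v≢x ∉∷ ~⇒≢ (~-sym yv) ∉∷ v≢z ∉∷ λ ()) l∉) of λ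
                { (inj₁ eq) → v≢x eq ; (inj₂ eq) → v≢m eq })

    outer-neighbour : ∀ {x} y z → 3 ≤ deg G x → ∃[ v ] x ~ v × v ∉ x ∷ y ∷ z ∷ []
    outer-neighbour {x} y z d with count-avoid (y ∷ z ∷ []) (adj G x) d
    ... | v , xv , v∉ = v , xv , (~⇒≢ (~-sym xv) ∉∷ v∉)

    triangle⇒family : ∀ {x y z} → Triangle x y z →
      TwoNontrivialComponents G x y → TwoNontrivialComponents G x z → TwoNontrivialComponents G y z →
      3 ≤ deg G x → 3 ≤ deg G y → 3 ≤ deg G z → InFamilyF G
    triangle⇒family {x} {y} {z} T cxy cxz cyz dx dy dz
      with outer-neighbour y z dx | outer-neighbour z x dy | outer-neighbour x y dz
         | house? (x ∷ y ∷ z ∷ []) x y | house? (x ∷ y ∷ z ∷ []) y z | house? (x ∷ y ∷ z ∷ []) x z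
    ... | k , xk , k∉ | m , ym , m∉ | l , zl , l∉ | hxy | hyz | hxz = cases hxy hyz hxz
      where
      open Triangle T
      C : List V
      C = x ∷ y ∷ z ∷ []
      C⁻ : ∀ {v} → v ∈ C → v ≡ x ⊎ v ≡ y ⊎ v ≡ z
      C⁻ (here e)                 = inj₁ e
      C⁻ (there (here e))         = inj₂ (inj₁ e)
      C⁻ (there (there (here e))) = inj₂ (inj₂ e)
      C⁺ : ∀ {v} → v ≡ x ⊎ v ≡ y ⊎ v ≡ z → v ∈ C
      C⁺ (inj₁ e)        = here e
      C⁺ (inj₂ (inj₁ e)) = there (here e)
      C⁺ (inj₂ (inj₂ e)) = there (there (here e))
      rotate-∈ : ∀ {v a b c : V} → v ≡ a ⊎ v ≡ b ⊎ v ≡ c → v ≡ b ⊎ v ≡ c ⊎ v ≡ a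
      rotate-∈ (inj₁ e)        = inj₂ (inj₂ e)
      rotate-∈ (inj₂ (inj₁ e)) = inj₁ e
      rotate-∈ (inj₂ (inj₂ e)) = inj₂ (inj₁ e)
      swap-∈ : ∀ {v a b c : V} → v ≡ a ⊎ v ≡ b ⊎ v ≡ c → v ≡ a ⊎ v ≡ c ⊎ v ≡ b
      swap-∈ (inj₁ e)        = inj₁ e
      swap-∈ (inj₂ (inj₁ e)) = inj₂ (inj₂ e)
      swap-∈ (inj₂ (inj₂ e)) = inj₂ (inj₁ e)
      k∉′ : k ∉ C
      k∉′ = k∉
      m∉′ : m ∉ C
      m∉′ = m∉ ∘ rotate₃ ∘ rotate₃
      l∉′ : l ∉ C
      l∉′ = l∉ ∘ rotate₃
      triple : Triple {C} x y z
      triple = Corner.some-adjacent eqm T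
      triple-yzx : Triple {C} y z x
      triple-yzx ya zb xc a∉ b∉ c∉ ab ac bc = triple xc ya zb c∉ a∉ b∉ (ac ∘ ~-sym) (bc ∘ ~-sym) ab
      triple-xzy : Triple {C} x z y
      triple-xzy xa zb yc a∉ b∉ c∉ ab ac bc = triple xa yc zb a∉ c∉ b∉ ac ab (bc ∘ ~-sym)
      someSeparated : ¬ ¬ ((∃[ K ] Separated C x y z K) ⊎ (∃[ K ] Separated C y z x K) ⊎ (∃[ K ] Separated C x z y K))
      someSeparated none =
        detached conn (~⇒≢ (~-sym xz)) (~⇒≢ (~-sym yz)) C⁻ C⁺ cxy λ (_ , z-detached) →
        detached conn (~⇒≢ (~-sym xy)) (~⇒≢ yz) (swap-∈ ∘ C⁻) (C⁺ ∘ swap-∈) cxz λ (_ , y-detached) →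
        detached conn (~⇒≢ xy) (~⇒≢ xz) (rotate-∈ ∘ C⁻) (C⁺ ∘ rotate-∈ ∘ rotate-∈) cyz λ (_ , x-detached) →
        case separate triple x-detached y-detached z-detached xk k∉′ ym m∉′ zl l∉′ of λ
          { (inj₁ s) → none (inj₁ (_ , s)) ; (inj₂ (inj₁ s)) → none (inj₂ (inj₁ (_ , s))) ; (inj₂ (inj₂ s)) → none (inj₂ (inj₂ (_ , s))) }
      -- A house over one edge of the triangle excludes separation of either end of that edge, so
      -- the third corner is the separated one. Searching for the house first makes the choice
      -- constructive.
      cases : Dec (House C x y) → Dec (House C y z) → Dec (House C x z) → InFamilyF G
      cases (yes H@(a , b , xa , yb , ab , a∉ , b∉)) _ _ = house⇒family T H zl l∉′ λ none → someSeparated λ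
        { (inj₁ s)                → none s
        ; (inj₂ (inj₁ (_ , s)))   → separated-apart s (inj₁ yb) xa b∉ a∉ (~-sym ab)
        ; (inj₂ (inj₂ (_ , s)))   → separated-apart s (inj₁ xa) yb a∉ b∉ ab }
      cases _ (yes (a , b , ya , zb , ab , a∉ , b∉)) _ =
        house⇒family (rotate-triangle T) (a , b , ya , zb , ab , (a∉ ∘ rotate₃) , (b∉ ∘ rotate₃)) xk (k∉′ ∘ rotate₃)
          λ none → someSeparated λ
            { (inj₁ (_ , s))          → separated-apart s (inj₂ ya) zb a∉ b∉ ab
            ; (inj₂ (inj₁ (_ , s)))   → none (_ , separated-⊆ (rotate₃ ∘ rotate₃) rotate₃ s)
            ; (inj₂ (inj₂ (_ , s)))   → separated-apart s (inj₂ zb) ya b∉ a∉ (~-sym ab) }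
      cases _ _ (yes (a , b , xa , zb , ab , a∉ , b∉)) =
        house⇒family (swap-triangle (rotate-triangle (rotate-triangle T)))
          (a , b , xa , zb , ab , (a∉ ∘ C⁺ ∘ swap-∈ ∘ D⁻) , (b∉ ∘ C⁺ ∘ swap-∈ ∘ D⁻)) ym (m∉′ ∘ C⁺ ∘ swap-∈ ∘ D⁻)
          λ none → someSeparated λ
            { (inj₁ (_ , s))          → separated-apart s (inj₁ xa) zb a∉ b∉ ab
            ; (inj₂ (inj₁ (_ , s)))   → separated-apart s (inj₂ zb) xa b∉ a∉ (~-sym ab)
            ; (inj₂ (inj₂ (_ , s)))   → none (_ , separated-⊆ (cons-⊆ pull₁) (cons-⊆ pull₁) s) }
        where
        D⁻ : ∀ {v} → v ∈ x ∷ z ∷ y ∷ [] → v ≡ x ⊎ v ≡ z ⊎ v ≡ y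
        D⁻ (here e)                 = inj₁ e
        D⁻ (there (here e))         = inj₂ (inj₁ e)
        D⁻ (there (there (here e))) = inj₂ (inj₂ e)
      cases (no ¬xy) (no ¬yz) (no ¬xz) = ⊥-elim (someSeparated λ
        { (inj₁ (_ , s))        → ¬xy (k , m , xk , ym , separated-adjacent triple s xk ym zl k∉′ m∉′ l∉′ , k∉′ , m∉′)
        ; (inj₂ (inj₁ (_ , s))) → ¬yz (m , l , ym , zl , separated-adjacent triple-yzx s ym zl xk m∉′ l∉′ k∉′ , m∉′ , l∉′)
        ; (inj₂ (inj₂ (_ , s))) → ¬xz (k , l , xk , zl , separated-adjacent triple-xzy s xk zl ym k∉′ l∉′ m∉′ , k∉′ , l∉′) })

theorem9 : ∀ {n} (G : Graph n) (x y z : Fin n) →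
    Connected G → WellEdgeDominated G →
    adj G x y ≡ true → adj G x z ≡ true → adj G y z ≡ true →
    (∀ a b c → adj G a b ≡ true → adj G b c ≡ true → adj G a c ≡ true →
    OneOf3 x y z a × OneOf3 x y z b × OneOf3 x y z c) →
    TwoNontrivialComponents G x y → TwoNontrivialComponents G x z →
    TwoNontrivialComponents G y z →
    3 ≤ deg G x → 3 ≤ deg G y → 3 ≤ deg G z →
    InFamilyF G
theorem9 G x y z conn wed xy xz yz only = Assembly.triangle⇒family G conn
  (subst (Equimatchable []) number≡ (equimatchable wed)) (λ g → trans (good-number wed g) number≡)
  (record { xy = xy ; xz = xz ; yz = yz ; only = only })
  where
  open Domination G
  -- The edge xy makes the matching number positive, hence of the form `suc h`.
  number≡ : matchingNumber wed ≡ suc (length (proj₁ (maximalMatching (x ∷ y ∷ []))))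
  number≡ = let L , val , max = maximalMatching (x ∷ y ∷ []) in
    sym (equimatchable wed (add xy (λ ()) (λ ()) val) λ e fp fq → max e (free-shift fp) (free-shift fq))
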